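{- Let $\mathcal{L}'$ be a first-order language and $\mathcal{N}$ an $\mathcal{L}'$-structure. Then the following are equivalent: (1) $\mathcal{N}$ has the finitary embedding Ramsey property. (2) $\mathcal{N}$ has the modelling property.
   Context: Structures need not be relational or locally finite. $\mathrm{Age}(\mathcal{N})$ is the class of (isomorphism types of) finitely generated substructures of $\mathcal{N}$, treated as an isomorphism-closed class. All types are over $\emptyset$ and quantifier-free types $\mathrm{qftp}$ are complete and computed in the ambient structure. Finitary ERP. For structures $M,N$, a finite subset $A\subseteq M$ and a subset $C\subseteq N$, $\binom{C}{A}$ is the set of copies of $A$ in $C$ with the same quantifier-free type, i.e. the set of maps $f:A\to C$ with $\mathrm{qftp}_N(f(\bar a))=\mathrm{qftp}_M(\bar a)$ for an enumeration $\bar a$ of $A$. Write $C\to(B)^A_2$ if for every $\chi:\binom{C}{A}\to\{0,1\}$ there is $e\in\binom{C}{B}$ such that $\chi$ is constant on the set of those $f\in\binom{C}{A}$ with image contained in $e(B)$. $\mathcal{N}$ has the finitary embedding Ramsey property if for every $M\in\mathrm{Age}(\mathcal{N})$ and all finite subsets $A,B\subseteq M$ there are $N\in\mathrm{Age}(\mathcal{N})$ and a finite $C\subseteq N$ with $C\to(B)^A_2$. Modelling property. For a set $\Delta$ of formulas, $\mathrm{tp}^\Delta(\bar a)$ is the restriction of $\mathrm{tp}(\bar a)$ to formulas and negations of formulas in $\Delta$. Let $T$ be a complete theory with infinite models in a language $\mathcal{L}$ and let $\mathbb{M}\models T$ be $\kappa$-saturated and $\kappa$-homogeneous for a large cardinal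 $\kappa$ (in particular larger than $|\mathcal{L}|$, $|\mathcal{N}|$ and the length of the tuples considered). All sequences consist of tuples of the same length. $(\bar a_i:i\in\mathcal{N})$ from $\mathbb{M}$ is $\mathcal{N}$-indiscernible if for all $n$ and $i_1,\dots,i_n,j_1,\dots,j_n\in\mathcal{N}$, $\mathrm{qftp}_{\mathcal{N}}(i_1,\dots,i_n)=\mathrm{qftp}_{\mathcal{N}}(j_1,\dots,j_n)$ implies $\mathrm{tp}_{\mathbb{M}}(\bar a_{i_1},\dots,\bar a_{i_n})=\mathrm{tp}_{\mathbb{M}}(\bar a_{j_1},\dots,\bar a_{j_n})$. $(\bar b_i:i\in\mathcal{N})$ is (locally) based on $(\bar a_i:i\in\mathcal{N})$ if for every finite set $\Delta$ of $\mathcal{L}$-formulas, every $n$ and all $i_1,\dots,i_n\in\mathcal{N}$ there are $j_1,\dots,j_n\in\mathcal{N}$ with $\mathrm{qftp}_{\mathcal{N}}(\bar i)=\mathrm{qftp}_{\mathcal{N}}(\bar j)$ and $\mathrm{tp}^\Delta_{\mathbb{M}}(\bar b_{i_1},\dots,\bar b_{i_n})=\mathrm{tp}^\Delta_{\mathbb{M}}(\bar a_{j_1},\dots,\bar a_{j_n})$. $\mathcal{N}$ has the modelling property if for every such $T$ (in any language) and every $\mathcal{N}$-indexed sequence of tuples from $\mathbb{M}\models T$ there is an $\mathcal{N}$-indiscernible sequence in $\mathbb{M}$ based on it. -}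

module Defs where

open import Level using (Level; Lift; _⊔_)
open import Data.Empty using (⊥)
open import Data.Fin.Base using (Fin; zero; suc)
open import Data.Irrelevant as Irrelevant using (Irrelevant; [_])
open import Data.List.Base using (List)
open import Data.List.Membership.Propositional using () renaming (_∈_ to _∈ˡ_)
open import Data.List.Relation.Unary.All using (All)
open import Data.Maybe.Base using (Maybe; just; nothing; maybe′)
open import Data.Nat.Base using (ℕ; zero; suc)
open import Data.Product.Base using (Σ; Σ-syntax; ∃-syntax; _×_; _,_)
open import Data.Refinement using (Refinement; Refinement-syntax; value; proof; _,_)
open import Data.Sum.Base using (_⊎_)
open import Data.Vec.Functional using (Vector)
open import Function.Base using (_∘_)
open import Function.Bundles using (_↣_; _↔_; _⇔_; module Injection; module Inverse)
open import Relation.Binary.PropositionalEquality.Core using (_≡_)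
open import Relation.Nullary.Negation.Core using (¬_)
open import Relation.Unary using (Pred; _≐_)

------------------------------------------------------------------------
-- First-order logic.  "Sets" are the types in Set ℓ, with _≡_ as equality.

record Language (ℓ : Level) : Set (Level.suc ℓ) where
  field
    Func : ℕ → Set ℓ
    Rel  : ℕ → Set ℓ

open Language public

record Structure {ℓ : Level} (L : Language ℓ) : Set (Level.suc ℓ) where
  field
    Carrier : Set ℓ
    func    : ∀ {n} → Func L n → Vector Carrier n → Carrier
    rel     : ∀ {n} → Rel L n → Vector Carrier n → Set ℓ

open Structure public

data Term {ℓ v : Level} (L : Language ℓ) (V : Set v) : Set (ℓ ⊔ v) where
  var : V → Term L V
  app : ∀ {n} → Func L n → Vector (Term L V) n → Term L V

-- Formulas with free variables in V; a quantifier binds the variable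
-- `nothing`.  The connectives ⊥, ⇒, ∀ are complete classically.
data Formula {ℓ v : Level} (L : Language ℓ) (V : Set v) : Set (ℓ ⊔ v) where
  ⊥′   : Formula L V
  _≈′_ : Term L V → Term L V → Formula L V
  rel′ : ∀ {n} → Rel L n → Vector (Term L V) n → Formula L V
  _⇒′_ : Formula L V → Formula L V → Formula L V
  ∀′_  : Formula L (Maybe V) → Formula L V

infix  8 _≈′_
infixr 6 _⇒′_
infix  5 ∀′_
infix  9 ¬′_

¬′_ : ∀ {ℓ v} {L : Language ℓ} {V : Set v} → Formula L V → Formula L V
¬′ φ = φ ⇒′ ⊥′

data QuantifierFree {ℓ v : Level} {L : Language ℓ} {V : Set v} :
                    Formula L V → Set (ℓ ⊔ v) where
  ⊥′   : QuantifierFree ⊥′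
  _≈′_ : ∀ s t → QuantifierFree (s ≈′ t)
  rel′ : ∀ {n} (R : Rel L n) ts → QuantifierFree (rel′ R ts)
  _⇒′_ : ∀ {φ ψ} → QuantifierFree φ → QuantifierFree ψ → QuantifierFree (φ ⇒′ ψ)

module _ {ℓ : Level} {L : Language ℓ} (M : Structure L) where

  eval : ∀ {v} {V : Set v} → (V → Carrier M) → Term L V → Carrier M
  eval a (var x)    = a x
  eval a (app f ts) = func M f (λ k → eval a (ts k))

  Sat : ∀ {v} {V : Set v} → (V → Carrier M) → Formula L V → Set ℓ
  Sat a ⊥′          = Lift ℓ ⊥
  Sat a (s ≈′ t)    = eval a s ≡ eval a t
  Sat a (rel′ R ts) = rel M R (λ k → eval a (ts k))
  Sat a (φ ⇒′ ψ)    = Sat a φ → Sat a ψ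
  Sat a (∀′ φ)      = ∀ x → Sat (maybe′ a x) φ

  -- Types over ∅ of tuples indexed by V.  Equality of types is _≐_.
  tp : ∀ {v} {V : Set v} → (V → Carrier M) → Pred (Formula L V) ℓ
  tp a φ = Sat a φ

  qftp : ∀ {v} {V : Set v} → (V → Carrier M) → Pred (Formula L V) (ℓ ⊔ v)
  qftp a φ = QuantifierFree φ × Sat a φ

  tp[_] : ∀ {v} {V : Set v} → List (Formula L V) → (V → Carrier M) →
          Pred (Formula L V) (ℓ ⊔ v)
  tp[ Δ ] a φ = Sat a φ × (φ ∈ˡ Δ ⊎ (∃[ ψ ] ψ ∈ˡ Δ × φ ≡ ¬′ ψ))

------------------------------------------------------------------------
-- Ages

private
  sequence : ∀ {p n} {P : Fin n → Set p} →
             (∀ k → Irrelevant (P k)) → Irrelevant (∀ k → P k)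
  sequence {n = zero}  ps = [ (λ ()) ]
  sequence {n = suc n} ps =
    Irrelevant.zipWith (λ { p q zero → p ; p q (suc k) → q k })
                       (ps zero) (sequence (ps ∘ suc))

record _≅_ {ℓ : Level} {L : Language ℓ} (M N : Structure L) : Set ℓ where
  field
    bijection : Carrier M ↔ Carrier N

  open Inverse bijection public using (to; from)

  field
    func-homo : ∀ {n} (f : Func L n) xs → to (func M f xs) ≡ func N f (to ∘ xs)
    rel-iso   : ∀ {n} (R : Rel L n) xs → rel M R xs ⇔ rel N R (to ∘ xs)

module _ {ℓ : Level} {L : Language ℓ} (N : Structure L) where

  data Closure {n : ℕ} (g : Vector (Carrier N) n) : Pred (Carrier N) ℓ where
    gen : ∀ k → Closure g (g k)
    app : ∀ {m} (f : Func L m) xs → (∀ k → Closure g (xs k)) →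
          Closure g (func N f xs)

  -- The substructure generated by g; it is empty if there are neither
  -- generators nor constants.  Membership in the closure is an irrelevant
  -- component, so that the carrier is a genuine subset of that of N.
  ⟨_⟩ : ∀ {n} → Vector (Carrier N) n → Structure L
  Carrier ⟨ g ⟩      = [ x ∈ Carrier N ∣ Closure g x ]
  func    ⟨ g ⟩ f xs = func N f (value ∘ xs)
                     , Irrelevant.map (app f (value ∘ xs)) (sequence (proof ∘ xs))
  rel     ⟨ g ⟩ R xs = rel N R (value ∘ xs)

  Age : Pred (Structure L) ℓ
  Age M = ∃[ n ] Σ[ g ∈ Vector (Carrier N) n ] M ≅ ⟨ g ⟩

------------------------------------------------------------------------
-- Finitary embedding Ramsey property

-- Finite subsets, given by an enumeration without repetitions.
record FiniteSubset {ℓ : Level} (X : Set ℓ) : Set ℓ where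
  field
    size        : ℕ
    enumeration : Fin size ↣ X

  elements : Vector X size
  elements = Injection.to enumeration

open FiniteSubset public

module _ {ℓ : Level} {L : Language ℓ} {M N : Structure L} where

  -- Maps A → C are given on the positions in the enumerations.  That a map
  -- is a copy is an irrelevant component, so that colourings depend on the
  -- map only.
  Copy : FiniteSubset (Carrier N) → FiniteSubset (Carrier M) → Set ℓ
  Copy C A = [ f ∈ (Fin (size A) → Fin (size C))
             ∣ qftp N (elements C ∘ f) ≐ qftp M (elements A) ]

  _⟶⟨_⟩^_ : FiniteSubset (Carrier N) → FiniteSubset (Carrier M) →
            FiniteSubset (Carrier M) → Set ℓ
  C ⟶⟨ B ⟩^ A =
    (χ : Copy C A → Fin 2) →
    Σ[ e ∈ Copy C B ]
      let inImage : Copy C A → Set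
          inImage f = ∀ k → ∃[ l ] value f k ≡ value e l
      in ∀ f f′ → inImage f → inImage f′ → χ f ≡ χ f′

FinitaryERP : ∀ {ℓ} {L : Language ℓ} → Structure L → Set (Level.suc ℓ)
FinitaryERP {L = L} N₀ =
  (M : Structure L) → Age N₀ M → (A B : FiniteSubset (Carrier M)) →
  Σ[ N ∈ Structure L ] Age N₀ N ×
  Σ[ C ∈ FiniteSubset (Carrier N) ] _⟶⟨_⟩^_ {M = M} {N = N} C B A

------------------------------------------------------------------------
-- Theories and saturation

module _ {ℓ : Level} {L : Language ℓ} where

  Theory : Set (Level.suc ℓ)
  Theory = Pred (Formula L ⊥) ℓ

  _⊨_ : Structure L → Theory → Set ℓ
  M ⊨ T = ∀ {φ} → T φ → Sat M (λ ()) φ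

  _Entails_ : Theory → Formula L ⊥ → Set (Level.suc ℓ)
  T Entails φ = ∀ (M : Structure L) → M ⊨ T → Sat M (λ ()) φ

  Complete : Theory → Set (Level.suc ℓ)
  Complete T = (∃[ M ] M ⊨ T) × (∀ φ → T Entails φ ⊎ T Entails (¬′ φ))

  HasInfiniteModel : Theory → Set (Level.suc ℓ)
  HasInfiniteModel T = ∃[ M ] M ⊨ T × (ℕ ↣ Carrier M)

-- Cardinals are represented by types: A ≺ K says |A| < |K|.
_≺_ : ∀ {a k} → Set a → Set k → Set (a ⊔ k)
A ≺ K = (A ↣ K) × ¬ (K ↣ A)

infix 4 _≺_

-- |L| is taken to be the number of symbols plus ℵ₀.
Size : ∀ {ℓ} → Language ℓ → Set ℓ
Size L = (Σ ℕ (Func L) ⊎ Σ ℕ (Rel L)) ⊎ ℕ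

module _ {ℓ : Level} {L : Language ℓ} (K : Set ℓ) (M : Structure L) where

  -- Every set p(x) of formulas over fewer than K parameters c which is
  -- finitely satisfiable in M is realised in M; x is the variable `nothing`.
  Saturated : Set (Level.suc ℓ)
  Saturated =
    (P : Set ℓ) → P ≺ K → (c : P → Carrier M) →
    (p : Pred (Formula L (Maybe P)) ℓ) →
    (∀ Δ → All p Δ → ∃[ x ] All (Sat M (maybe′ c x)) Δ) →
    ∃[ x ] (∀ {φ} → p φ → Sat M (maybe′ c x) φ)

  -- Every partial elementary map c ↦ d with domain smaller than K extends
  -- to any further point.
  Homogeneous : Set (Level.suc ℓ)
  Homogeneous =
    (P : Set ℓ) → P ≺ K → (c d : P → Carrier M) → tp M c ≐ tp M d →
    ∀ x → ∃[ y ] tp M (maybe′ c x) ≐ tp M (maybe′ d y)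

------------------------------------------------------------------------
-- Modelling property

-- Λ is the length of the tuples in an N-indexed sequence.
module _ {ℓ : Level} {L′ L : Language ℓ} (N : Structure L′) (M : Structure L)
         {Λ : Set ℓ} where

  Sequence : Set ℓ
  Sequence = Carrier N → Λ → Carrier M

  concat : Sequence → ∀ {n} → Vector (Carrier N) n → Fin n × Λ → Carrier M
  concat a i (k , l) = a (i k) l

  Indiscernible : Sequence → Set ℓ
  Indiscernible a =
    ∀ n (i j : Vector (Carrier N) n) →
    qftp N i ≐ qftp N j → tp M (concat a i) ≐ tp M (concat a j)

  -- The formulas in Δ have free variables among those of an n-tuple of
  -- Λ-tuples, whence n is quantified before Δ.
  _BasedOn_ : Sequence → Sequence → Set ℓ
  b BasedOn a =
    ∀ n (Δ : List (Formula L (Fin n × Λ))) (i : Vector (Carrier N) n) →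
    Σ[ j ∈ Vector (Carrier N) n ]
      qftp N i ≐ qftp N j ×
      tp[_] M Δ (concat b i) ≐ tp[_] M Δ (concat a j)

ModellingProperty : ∀ {ℓ} {L′ : Language ℓ} → Structure L′ → Set (Level.suc ℓ)
ModellingProperty {ℓ} N =
  (L : Language ℓ) (T : Theory {L = L}) → Complete T → HasInfiniteModel T →
  (Λ K : Set ℓ) → Size L ≺ K → Carrier N ≺ K → Λ ≺ K →
  (M : Structure L) → M ⊨ T → Saturated K M → Homogeneous K M →
  (a : Sequence N M {Λ}) →
  Σ[ b ∈ Sequence N M {Λ} ] Indiscernible N M b × _BasedOn_ N M b a

{-# OPTIONS --safe #-}
-- Both properties are equivalent to a Ramsey property for tuples of N itself.
-- Iterating that property makes finitely many colourings of tuples of N constant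
-- on the copies inside an embedded copy of a given finite set; colouring a tuple i
-- by the truth of φ(a_i), this says that "indiscernible and based on a" is finitely
-- satisfiable, hence realised in a saturated structure.  Conversely, if the Ramsey
-- property fails, then by compactness a single colouring t of the tuples of N has no
-- homogeneous copy of B.  In a saturated structure with one generic relation, N can
-- be indexed so that the relation is t; an indiscernible sequence based on this one
-- takes the same colour on all copies of A in B, and so produces such a copy.
module Submission where

open import Defs
open import Level using (Level; Lift; lift; lower; _⊔_)
open import Axiom.ExcludedMiddle using (ExcludedMiddle)
open import Axiom.Extensionality.Propositional using (Extensionality)
open import Data.Bool.Base using (Bool; true; false; if_then_else_)
open import Data.Empty using (⊥; ⊥-elim)
open import Data.Fin.Base using (Fin; zero; suc; _↑ˡ_; _↑ʳ_)
open import Data.Fin.Properties using (2↔Bool)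
open import Data.Irrelevant using ([_])
open import Data.List.Base as List using (List; []; _∷_; _++_)
open import Data.List.Membership.Propositional using (_∈_; _∉_)
open import Data.List.Membership.Propositional.Properties
open import Data.List.Properties using (++-identityʳ)
open import Data.List.Relation.Unary.All as All using (All; []; _∷_)
open import Data.List.Relation.Unary.All.Properties using (++⁺; ++⁻ˡ; ++⁻ʳ)
open import Data.List.Relation.Unary.Any as Any using (Any; here; there)
open import Data.List.Relation.Unary.Any.Properties using (lookup-index)
open import Data.Maybe.Base as Maybe using (Maybe; just; nothing; maybe′; fromMaybe)
open import Data.Maybe.Properties using (just-injective)
open import Data.Nat.Base as ℕ using (ℕ; zero; suc)
open import Data.Product.Base using (Σ; Σ-syntax; ∃; _×_; _,_; proj₁; proj₂; map₁; uncurry)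
open import Data.Refinement using (Refinement-syntax; value; _,_)
open import Data.Sum.Base using (_⊎_; inj₁; inj₂; [_,_]′)
open import Data.Sum.Properties using (inj₁-injective; inj₂-injective)
open import Data.Unit.Base using (⊤; tt)
open import Data.Vec.Functional as Vector using (Vector)
open import Data.Vec.Functional.Properties using (lookup-++ˡ; lookup-++ʳ)
open import Function.Base using (id; _∘_)
open import Function.Bundles using (_⇔_; mk⇔; _↣_; mk↣; _↔_; module Injection; module Inverse; module Equivalence)
open import Function.Construct.Composition using (_↣-∘_)
open import Function.Construct.Identity using (↣-id; ↔-id; ⇔-id)
open import Function.Construct.Symmetry using (⇔-sym)
open import Function.Definitions using (Injective)
open import Relation.Binary.PropositionalEquality using (_≡_; _≢_; refl; sym; trans; cong; cong₂; subst; subst₂; cong-app)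
open import Relation.Nullary using (yes; no; does; ¬_; contradiction)
open import Relation.Nullary.Decidable using (decidable-stable; dec-true; dec-false; recompute)
open import Relation.Unary using (Pred; _≐_)
open import Relation.Unary.Properties using (≐-refl; ≐-sym; ≐-trans)

open Injection using () renaming (to to ⟦_⟧; injective to ↣-injective)

-- The choice behind Zorn's lemma comes from excluded middle itself, since deciding an existential
-- type yields a witness. Zorn's lemma is proved for partial functions and used four times: for
-- compactness, for comparing cardinals, for squares of infinite sets, and for passing from types in
-- one variable to types in many. The modelling property speaks only of saturated and homogeneous
-- structures, so the converse has to exhibit one, in the universe of `N`. An inductive type of
-- trees does this at once: a node lists `K` children and a Boolean table of the relations it has
-- with them, so every atomic type of a new element over at most `K` parameters is realised by
-- construction. No elementary chains are formed, and the size of the structure is never computed.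
-- Squares of cardinals enter only in the forward direction, where `K` is arbitrary and the
-- variables `Carrier N × Λ` must still be fewer than `K`.

module Classical (em : ∀ {a : Level} → ExcludedMiddle a)
                 (ext : ∀ {a b : Level} → Extensionality a b) where

  private
    variable
      ℓ₁ ℓ₂ ℓ₃ ℓ₄ : Level
      V : Set ℓ₁
      A : Set ℓ₂
      B : Set ℓ₃

  by-contradiction : ¬ ¬ A → A
  by-contradiction = decidable-stable em

  ⌊_⌋ : Set ℓ₁ → Bool
  ⌊ P ⌋ = does (em {P = P})

  ⌊⌋⁺ : {P : Set ℓ₁} → P → ⌊ P ⌋ ≡ true
  ⌊⌋⁺ = dec-true em

  ⌊⌋⁻ : {P : Set ℓ₁} → ⌊ P ⌋ ≡ true → P
  ⌊⌋⁻ {P = P} eq with em {P = P}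
  ... | yes p = p

  -- Zorn's lemma for partial functions

  _⊑_ : (V → Maybe A) → (V → Maybe A) → Set _
  d ⊑ e = ∀ v {m} → d v ≡ just m → e v ≡ just m

  ⊑-antisym-at : ∀ {x y : Maybe A} → (∀ {m} → x ≡ just m → y ≡ just m) →
                 (∀ {m} → y ≡ just m → x ≡ just m) → x ≡ y
  ⊑-antisym-at {x = just m} p q = sym (p refl)
  ⊑-antisym-at {x = nothing} {just m} p q = q refl
  ⊑-antisym-at {x = nothing} {nothing} p q = refl

  ⊑-antisym : {d e : V → Maybe A} → d ⊑ e → e ⊑ d → d ≡ e
  ⊑-antisym p q = ext λ v → ⊑-antisym-at (p v) (q v)

  ⊑-refl : {d : V → Maybe A} → d ⊑ d
  ⊑-refl v = id

  ⊑-trans : {d e f : V → Maybe A} → d ⊑ e → e ⊑ f → d ⊑ f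
  ⊑-trans p q v = q v ∘ p v

  -- Sets of partial functions are Boolean-valued so that quantifying over them, as `join` does in
  -- `Tower`, does not raise the universe level.
  Chain : ((V → Maybe A) → Bool) → Set _
  Chain C = ∀ {d e} → C d ≡ true → C e ≡ true → d ⊑ e ⊎ e ⊑ d

  ⋃ : ((V → Maybe A) → Bool) → V → Maybe A
  ⋃ C v with em {P = ∃ λ m → ∃ λ d → C d ≡ true × d v ≡ just m}
  ... | yes (m , _) = just m
  ... | no _ = nothing

  ⋃-source : ∀ (C : (V → Maybe A) → Bool) {v m} → ⋃ C v ≡ just m →
             ∃ λ d → C d ≡ true × d v ≡ just m
  ⋃-source C {v} eq with em {P = ∃ λ m → ∃ λ d → C d ≡ true × d v ≡ just m}
  ⋃-source C refl | yes (m , p) = p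

  ⋃-upper : ∀ {C : (V → Maybe A) → Bool} {d} → Chain C → C d ≡ true → d ⊑ ⋃ C
  ⋃-upper {C = C} {d} chain Cd v dv
    with em {P = ∃ λ m → ∃ λ d → C d ≡ true × d v ≡ just m}
  ... | no ¬p = contradiction (_ , d , Cd , dv) ¬p
  ... | yes (_ , d′ , Cd′ , d′v) with chain Cd Cd′
  ...   | inj₁ d⊑d′ = trans (sym d′v) (d⊑d′ v dv)
  ...   | inj₂ d′⊑d = trans (sym (d′⊑d v d′v)) dv

  ⋃-least : ∀ {C : (V → Maybe A) → Bool} {e} → (∀ d → C d ≡ true → d ⊑ e) → ⋃ C ⊑ e
  ⋃-least {C = C} p v eq = let d , Cd , dv = ⋃-source C eq in p d Cd v dv

  -- Finitely many values of the union come from finitely many members, and in a chain one of these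
  -- is the largest; `d₀` serves when nothing is defined on `F`.
  ⋃-local : ∀ {C : (V → Maybe A) → Bool} {d₀} → Chain C → C d₀ ≡ true → ∀ F →
            ∃ λ d → C d ≡ true × (∀ {v} → v ∈ F → d v ≡ ⋃ C v)
  ⋃-local {C = C} {d₀} chain Cd₀ F =
    let d , Cd , p = go F
    in d , Cd , λ v∈F → ⊑-antisym-at (⋃-upper {C = C} chain Cd _) (p v∈F)
    where
    go : ∀ F → ∃ λ d → C d ≡ true × (∀ {v m} → v ∈ F → ⋃ C v ≡ just m → d v ≡ just m)
    go [] = d₀ , Cd₀ , λ ()
    go (v ∷ F) with go F | ⋃ C v in eq
    ... | d , Cd , p | nothing =
      d , Cd , λ { (here refl) q → contradiction (trans (sym eq) q) λ ()
                 ; (there w∈F) q → p w∈F q }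
    ... | d , Cd , p | just m with ⋃-source C eq
    ...   | d′ , Cd′ , d′v with chain Cd Cd′
    ...     | inj₁ d⊑d′ = d′ , Cd′ , λ { (here refl) q → trans d′v (trans (sym eq) q)
                                       ; (there w∈F) q → d⊑d′ _ (p w∈F q) }
    ...     | inj₂ d′⊑d = d , Cd , λ { (here refl) q → trans (d′⊑d v d′v) (trans (sym eq) q)
                                     ; (there w∈F) q → p w∈F q }

  -- `closed` expresses finite character without mentioning chains, so that each application only
  -- inspects finitely many arguments; `⋃-local` turns it into closure under unions of chains.
  module Zorn {V : Set ℓ₁} {A : Set ℓ₂} (Good : (V → Maybe A) → Set ℓ₄)
    (closed : ∀ u → (∀ F → ∃ λ d → Good d × (∀ {v} → v ∈ F → d v ≡ u v)) → Good u)
    (d₀ : V → Maybe A) (good₀ : Good d₀) where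

    Extension : (V → Maybe A) → Set _
    Extension d = ∃ λ d′ → Good d′ × d ⊑ d′ × d′ ≢ d

    step : (V → Maybe A) → V → Maybe A
    step d with em {P = Extension d}
    ... | yes (d′ , _) = d′
    ... | no _ = d

    step-⊒ : ∀ {d} → d ⊑ step d
    step-⊒ {d} with em {P = Extension d}
    ... | yes (_ , _ , p , _) = p
    ... | no _ = ⊑-refl

    step-Good : ∀ {d} → Good d → Good (step d)
    step-Good {d} good with em {P = Extension d}
    ... | yes (_ , p , _) = p
    ... | no _ = good

    step-maximal : ∀ {d} → step d ≡ d → ∀ {d′} → Good d′ → d ⊑ d′ → d′ ≡ d
    step-maximal {d} eq good d⊑d′ with em {P = Extension d}
    ... | yes (_ , _ , _ , ≢d) = contradiction eq ≢d
    ... | no ¬e = by-contradiction λ ≢d → ¬e (_ , good , d⊑d′ , ≢d)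

    -- As in the Bourbaki-Witt theorem, the least family containing `d₀` and closed under `step` and
    -- unions of inhabited chains replaces transfinite iteration. That it is a chain is proved
    -- through its extreme members.
    data Tower : (V → Maybe A) → Set (ℓ₁ ⊔ ℓ₂) where
      base : Tower d₀
      next : ∀ {d} → Tower d → Tower (step d)
      join : ∀ C {d} → Chain C → C d ≡ true → (∀ {e} → C e ≡ true → Tower e) → Tower (⋃ C)

    Tower-Good : ∀ {d} → Tower d → Good d
    Tower-Good base = good₀
    Tower-Good (next t) = step-Good (Tower-Good t)
    Tower-Good (join C chain Cd t) = closed (⋃ C) λ F →
      let e , Ce , p = ⋃-local {C = C} chain Cd F in e , Tower-Good (t Ce) , p

    Tower-⊒ : ∀ {d} → Tower d → d₀ ⊑ d
    Tower-⊒ base = ⊑-refl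
    Tower-⊒ (next t) = ⊑-trans (Tower-⊒ t) step-⊒
    Tower-⊒ (join C chain Cd t) = ⊑-trans (Tower-⊒ (t Cd)) (⋃-upper {C = C} chain Cd)

    Extreme : (V → Maybe A) → Set _
    Extreme d = ∀ {e} → Tower e → e ⊑ d → e ≢ d → step e ⊑ d

    comparable : ∀ {d} → Tower d → Extreme d → ∀ {e} → Tower e → e ⊑ d ⊎ step d ⊑ e
    comparable td xd base = inj₁ (Tower-⊒ td)
    comparable {d} td xd (next {e} te) with comparable td xd te
    ... | inj₂ p = inj₂ (⊑-trans p step-⊒)
    ... | inj₁ e⊑d with em {P = e ≡ d}
    ...   | yes refl = inj₂ ⊑-refl
    ...   | no e≢d = inj₁ (xd te e⊑d e≢d)
    comparable {d} td xd (join C chain _ t) with em {P = ∃ λ e → C e ≡ true × step d ⊑ e}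
    ... | yes (e , Ce , p) = inj₂ (⊑-trans p (⋃-upper {C = C} chain Ce))
    ... | no ¬p = inj₁ (⋃-least {C = C} λ e Ce →
                    [ id , (λ q → contradiction (e , Ce , q) ¬p) ]′
                      (comparable td xd (t Ce)))

    extreme : ∀ {d} → Tower d → Extreme d
    extreme base te e⊑d₀ e≢d₀ = contradiction (⊑-antisym e⊑d₀ (Tower-⊒ te)) e≢d₀
    extreme (next {d} td) {e} te e⊑d e≢d with comparable td (extreme td) te
    ... | inj₂ p = contradiction (⊑-antisym e⊑d p) e≢d
    ... | inj₁ e⊑d′ with em {P = e ≡ d}
    ...   | yes refl = ⊑-refl
    ...   | no e≢d′ = ⊑-trans (extreme td te e⊑d′ e≢d′) step-⊒
    extreme (join C chain Cd t) {e} te e⊑ e≢ with em {P = ∃ λ c → C c ≡ true × ¬ (step c ⊑ e)}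
    ... | no ¬p = contradiction (⊑-antisym e⊑ (⋃-least {C = C} λ c Cc →
                    ⊑-trans step-⊒ (by-contradiction λ q → ¬p (c , Cc , q)))) e≢
    ... | yes (c , Cc , ¬q) with comparable (t Cc) (extreme (t Cc)) te
    ...   | inj₂ q = contradiction q ¬q
    ...   | inj₁ e⊑c with em {P = e ≡ c}
    ...     | no e≢c = ⊑-trans (extreme (t Cc) te e⊑c e≢c) (⋃-upper {C = C} chain Cc)
    -- Here `e` is itself a member of the chain, hence extreme, so the whole union can be compared
    -- with it.
    ...     | yes refl with comparable te (extreme (t Cc)) (join C chain Cd t)
    ...       | inj₁ q = contradiction (⊑-antisym e⊑ q) e≢
    ...       | inj₂ q = q

    zorn : ∃ λ d → Good d × d₀ ⊑ d × (∀ {d′} → Good d′ → d ⊑ d′ → d′ ≡ d)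
    zorn = top , Tower-Good tower-top , Tower-⊒ tower-top ,
      -- `top` is the union of the whole tower and belongs to it; so does `step top`, which
      -- therefore lies below `top`.
      step-maximal (⊑-antisym (⋃-upper {C = C} chain (⌊⌋⁺ (next tower-top))) step-⊒)
      where
      C : (V → Maybe A) → Bool
      C d = ⌊ Tower d ⌋
      chain : Chain C
      chain Cd Ce with comparable (⌊⌋⁻ Cd) (extreme (⌊⌋⁻ Cd)) (⌊⌋⁻ Ce)
      ... | inj₁ p = inj₂ p
      ... | inj₂ p = inj₁ (⊑-trans step-⊒ p)
      top : V → Maybe A
      top = ⋃ C
      tower-top : Tower top
      tower-top = join C chain (⌊⌋⁺ base) ⌊⌋⁻

  _[_≔_] : (V → A) → V → A → V → A
  (d [ v ≔ m ]) w with em {P = w ≡ v}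
  ... | yes _ = m
  ... | no _ = d w

  ≔-same : (d : V → A) {v : V} {m : A} → (d [ v ≔ m ]) v ≡ m
  ≔-same d {v} with em {P = v ≡ v}
  ... | yes _ = refl
  ... | no v≢v = contradiction refl v≢v

  ≔-other : (d : V → A) {v w : V} {m : A} → w ≢ v → (d [ v ≔ m ]) w ≡ d w
  ≔-other d {v} {w} w≢v with em {P = w ≡ v}
  ... | yes w≡v = contradiction w≡v w≢v
  ... | no _ = refl

  ≔-elim : (d : V → A) {v : V} {m : A} (P : V → A → Set ℓ₄) → P v m →
           (∀ w → w ≢ v → P w (d w)) → ∀ w → P w ((d [ v ≔ m ]) w)
  ≔-elim d {v} P p q w with em {P = w ≡ v}
  ... | yes refl = p
  ... | no w≢v = q w w≢v

  ≔-⊒ : (d : V → Maybe A) {v : V} {m : Maybe A} → d v ≡ nothing → d ⊑ (d [ v ≔ m ])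
  ≔-⊒ d {v} dv w {m} dw = trans (≔-other d {m = _} λ { refl → contradiction (trans (sym dv) dw) λ () }) dw

  ≢nothing⇒≡just : {x : Maybe A} → x ≢ nothing → ∃ λ m → x ≡ just m
  ≢nothing⇒≡just {x = just m} _ = m , refl
  ≢nothing⇒≡just {x = nothing} x≢ = contradiction refl x≢

  maximal⇒total : {Good : (V → Maybe A) → Set ℓ₄} {d : V → Maybe A} →
                  (∀ {d′} → Good d′ → d ⊑ d′ → d′ ≡ d) →
                  (∀ {v} → d v ≡ nothing → ∃ λ m → Good (d [ v ≔ just m ])) →
                  ∃ λ (u : V → A) → ∀ v → d v ≡ just (u v)
  maximal⇒total {d = d} max extend = (λ v → proj₁ (defined v)) , (λ v → proj₂ (defined v))
    where
    defined : ∀ v → ∃ λ m → d v ≡ just m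
    defined v = ≢nothing⇒≡just λ dv →
      let m , good = extend dv
      in contradiction (trans (sym (trans (cong-app (sym (max good (≔-⊒ d dv))) v) (≔-same d))) dv) λ ()

  -- Compactness of 2^A

  abstract
    compactness : ∀ {i a p} {I : Set i} {A : Set a} (P : I → (A → Bool) → Set p) →
      I → (∀ i j → ∃ λ k → ∀ t → P k t → P i t × P j t) → (∀ i → ∃ (P i)) →
      ∃ λ (t : A → Bool) → ∀ i (F : List A) → ∃ λ t′ → P i t′ × (∀ {x} → x ∈ F → t′ x ≡ t x)
    compactness {i} {a} {p} {I} {A} P i₀ directed inhabited =
      let d , good , _ , max = zorn
          t , d≡t = maximal⇒total {Good = Good} max (extend good)
      in t , λ i F → let t′ , Pt′ , p = good i F in t′ , Pt′ , λ x∈F → p x∈F (d≡t _)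
      where
      -- No finite part of `d` is incompatible with any `P i`: in topological terms, every cylinder
      -- around `d` meets every `P i`.
      Good : (A → Maybe Bool) → Set (i ⊔ a ⊔ p)
      Good d = ∀ i F → ∃ λ t → P i t × (∀ {x b} → x ∈ F → d x ≡ just b → t x ≡ b)

      closed : ∀ u → (∀ F → ∃ λ d → Good d × (∀ {v} → v ∈ F → d v ≡ u v)) → Good u
      closed u approx i F =
        let d , good , d≡u = approx F
            t , Pt , p = good i F
        in t , Pt , λ x∈F ux → p x∈F (trans (d≡u x∈F) ux)

      empty-Good : Good (λ _ → nothing)
      empty-Good i F = let t , Pt = inhabited i in t , Pt , λ _ ()

      open Zorn Good closed (λ _ → nothing) empty-Good

      Bad : (A → Maybe Bool) → I → List A → Set (a ⊔ p)
      Bad d i F = ∀ t → P i t → ¬ (∀ {x b} → x ∈ F → d x ≡ just b → t x ≡ b)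

      bad : ∀ d → ¬ Good d → ∃ λ i → ∃ λ F → Bad d i F
      bad d ¬good = by-contradiction λ ¬bad → ¬good λ i F → by-contradiction λ ¬t →
        ¬bad (i , F , λ t Pt p → ¬t (t , Pt , p))

      extend : ∀ {d} → Good d → ∀ {x} → d x ≡ nothing → ∃ λ b → Good (d [ x ≔ just b ])
      extend {d} good {x} dx with em {P = Good (d [ x ≔ just true ])} | em {P = Good (d [ x ≔ just false ])}
      ... | yes g | _ = true , g
      ... | no _ | yes g = false , g
      -- Each value at `x` is excluded by some index and some finite set. A `t` from a common
      -- refinement of the two indices, compatible with `d` on both sets, has one of the two values
      -- at `x` and contradicts that exclusion.
      ... | no ¬g | no ¬g′ =
        let i , F , q = bad _ ¬g
            j , G , r = bad _ ¬g′
            k , below = directed i j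
            t , Pt , p = good k (F ++ G)
            Pi , Pj = below t Pt
        in ⊥-elim (conflict t Pi Pj (λ e → p (∈-++⁺ˡ e)) (λ e → p (∈-++⁺ʳ F e)) q r (t x) refl)
        where
        conflict : ∀ t {i j F G} → P i t → P j t →
          (∀ {y b} → y ∈ F → d y ≡ just b → t y ≡ b) → (∀ {y b} → y ∈ G → d y ≡ just b → t y ≡ b) →
          Bad (d [ x ≔ just true ]) i F → Bad (d [ x ≔ just false ]) j G → ∀ b → t x ≡ b → ⊥
        conflict t Pi Pj p p′ q r true tx = q t Pi λ {y} {b} y∈F →
          ≔-elim d (λ y m → y ∈ _ → m ≡ just b → t y ≡ b)
            (λ _ eq → trans tx (just-injective eq)) (λ _ _ e eq → p e eq) y y∈F
        conflict t Pi Pj p p′ q r false tx = r t Pj λ {y} {b} y∈G →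
          ≔-elim d (λ y m → y ∈ _ → m ≡ just b → t y ≡ b)
            (λ _ eq → trans tx (just-injective eq)) (λ _ _ e eq → p′ e eq) y y∈G

  -- Cardinal arithmetic

  module _ (A : Set ℓ₁) (B : Set ℓ₂) where

    private
      Good : (A → Maybe B) → Set _
      Good d = ∀ {x y m} → d x ≡ just m → d y ≡ just m → x ≡ y

      closed : ∀ u → (∀ F → ∃ λ d → Good d × (∀ {v} → v ∈ F → d v ≡ u v)) → Good u
      closed u approx {x} {y} ux uy =
        let d , good , d≡u = approx (x ∷ y ∷ [])
        in good (trans (d≡u (here refl)) ux) (trans (d≡u (there (here refl))) uy)

      empty-Good : Good (λ _ → nothing)
      empty-Good ()

      open Zorn Good closed (λ _ → nothing) empty-Good

    -- A maximal partial injection is total or onto: a value it misses could be assigned to any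
    -- point where it is undefined.
    ↣-total : (A ↣ B) ⊎ (B ↣ A)
    ↣-total with zorn
    ... | d , good , _ , max with em {P = ∃ λ m → ∀ x → d x ≢ just m}
    ...   | no ¬p = inj₂ (mk↣ {to = λ m → proj₁ (hit m)} λ {m} {n} eq →
              just-injective (trans (sym (proj₂ (hit m))) (trans (cong d eq) (proj₂ (hit n)))))
      where
      hit : ∀ m → ∃ λ x → d x ≡ just m
      hit m = by-contradiction λ ¬x → ¬p (m , λ x dx → ¬x (x , dx))
    ...   | yes (m , fresh) =
      let u , d≡u = maximal⇒total {Good = Good} max λ {v} _ → m , extended {v}
      in inj₁ (mk↣ {to = u} λ {x} {y} eq → good (trans (d≡u x) (cong just eq)) (d≡u y))
      where
      extended : ∀ {v} → Good (d [ v ≔ just m ])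
      extended {v} {x} {y} {n} =
        ≔-elim d (λ x k → k ≡ just n → (d [ v ≔ just m ]) y ≡ just n → x ≡ y)
          (λ { refl → ≔-elim d (λ y k → k ≡ just m → v ≡ y) (λ _ → refl)
                        (λ w _ dw → contradiction dw (fresh w)) y })
          (λ x _ dx → ≔-elim d (λ y k → k ≡ just n → x ≡ y)
                        (λ { refl → contradiction dx (fresh x) })
                        (λ y _ dy → good dx dy) y) x

  ≺-respˡ-↣ : {A : Set ℓ₁} {B : Set ℓ₂} {K : Set ℓ₃} → A ↣ B → B ≺ K → A ≺ K
  ≺-respˡ-↣ A↣B (B↣K , K↣̸B) = B↣K ↣-∘ A↣B , λ K↣A → K↣̸B (A↣B ↣-∘ K↣A)

  double : ℕ → ℕ
  double zero = zero
  double (suc n) = suc (suc (double n))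

  double-injective : ∀ m n → double m ≡ double n → m ≡ n
  double-injective zero zero _ = refl
  double-injective (suc m) (suc n) eq = cong suc (double-injective m n (cong (ℕ.pred ∘ ℕ.pred) eq))

  double≢suc-double : ∀ m n → double m ≢ suc (double n)
  double≢suc-double (suc m) (suc n) eq = double≢suc-double m n (cong (ℕ.pred ∘ ℕ.pred) eq)

  -- The pair (m , n) is coded by 2ᵐ (2n + 1).
  ℕ-pair : ℕ × ℕ → ℕ
  ℕ-pair (zero , n) = suc (double n)
  ℕ-pair (suc m , n) = double (ℕ-pair (m , n))

  ℕ-pair-injective : ∀ p q → ℕ-pair p ≡ ℕ-pair q → p ≡ q
  ℕ-pair-injective (zero , n) (zero , n′) eq = cong (zero ,_) (double-injective n n′ (cong ℕ.pred eq))
  ℕ-pair-injective (zero , n) (suc m , n′) eq = contradiction (sym eq) (double≢suc-double (ℕ-pair (m , n′)) n)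
  ℕ-pair-injective (suc m , n) (zero , n′) eq = contradiction eq (double≢suc-double (ℕ-pair (m , n)) n′)
  ℕ-pair-injective (suc m , n) (suc m′ , n′) eq =
    cong (map₁ suc) (ℕ-pair-injective (m , n) (m′ , n′) (double-injective _ _ eq))

  value-injective : {P : Pred A ℓ₄} {x y : [ x ∈ A ∣ P x ]} → value x ≡ value y → x ≡ y
  value-injective refl = refl

  -- X × X ↣ X is obtained from a maximal injection S × S ↣ S with ℕ ⊆ S ⊆ X.
  module Square {X : Set ℓ₁} (ι : ℕ ↣ X) where

    private
      -- The set S is read off the diagonal, so a single partial function carries both S and the
      -- injection.
      dom : (X × X → Maybe X) → X → Set _
      dom d x = ∃ λ z → d (x , x) ≡ just z

      record Good (d : X × X → Maybe X) : Set ℓ₁ where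
        field
          domˡ  : ∀ {x y z} → d (x , y) ≡ just z → dom d x
          domʳ  : ∀ {x y z} → d (x , y) ≡ just z → dom d y
          cod   : ∀ {x y z} → d (x , y) ≡ just z → dom d z
          total : ∀ {x y} → dom d x → dom d y → ∃ λ z → d (x , y) ≡ just z
          inj   : ∀ {p q z} → d p ≡ just z → d q ≡ just z → p ≡ q

      closed : ∀ u → (∀ F → ∃ λ d → Good d × (∀ {v} → v ∈ F → d v ≡ u v)) → Good u
      closed u approx = record
        { domˡ  = λ {x} {y} uxy → let d , good , eq = approx ((x , y) ∷ (x , x) ∷ [])
                                      z , dx = domˡ good (trans (eq (here refl)) uxy)
                                  in z , trans (sym (eq (there (here refl)))) dx
        ; domʳ  = λ {x} {y} uxy → let d , good , eq = approx ((x , y) ∷ (y , y) ∷ [])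
                                      z , dy = domʳ good (trans (eq (here refl)) uxy)
                                  in z , trans (sym (eq (there (here refl)))) dy
        ; cod   = λ {x} {y} {z} uxy → let d , good , eq = approx ((x , y) ∷ (z , z) ∷ [])
                                          w , dz = cod good (trans (eq (here refl)) uxy)
                                      in w , trans (sym (eq (there (here refl)))) dz
        ; total = λ {x} {y} (z , ux) (w , uy) →
                    let d , good , eq = approx ((x , x) ∷ (y , y) ∷ (x , y) ∷ [])
                        v , dxy = total good (z , trans (eq (here refl)) ux) (w , trans (eq (there (here refl))) uy)
                    in v , trans (sym (eq (there (there (here refl))))) dxy
        ; inj   = λ {p} {q} up uq →
                    let d , good , eq = approx (p ∷ q ∷ [])
                    in inj good (trans (eq (here refl)) up) (trans (eq (there (here refl))) uq)
        }
        where open Good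

      d₀ : X × X → Maybe X
      d₀ (x , y) with em {P = ∃ λ m → ∃ λ n → ⟦ ι ⟧ m ≡ x × ⟦ ι ⟧ n ≡ y}
      ... | yes (m , n , _) = just (⟦ ι ⟧ (ℕ-pair (m , n)))
      ... | no _ = nothing

      d₀⁺ : ∀ m n → d₀ (⟦ ι ⟧ m , ⟦ ι ⟧ n) ≡ just (⟦ ι ⟧ (ℕ-pair (m , n)))
      d₀⁺ m n with em {P = ∃ λ k → ∃ λ l → ⟦ ι ⟧ k ≡ ⟦ ι ⟧ m × ⟦ ι ⟧ l ≡ ⟦ ι ⟧ n}
      ... | yes (k , l , p , q) rewrite ↣-injective ι p | ↣-injective ι q = refl
      ... | no ¬p = contradiction (m , n , refl , refl) ¬p

      Coded : X → X → X → Set _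
      Coded x y z = ∃ λ m → ∃ λ n → ⟦ ι ⟧ m ≡ x × ⟦ ι ⟧ n ≡ y × ⟦ ι ⟧ (ℕ-pair (m , n)) ≡ z

      d₀⁻ : ∀ {x y z} → d₀ (x , y) ≡ just z → Coded x y z
      d₀⁻ {x} {y} eq with em {P = ∃ λ m → ∃ λ n → ⟦ ι ⟧ m ≡ x × ⟦ ι ⟧ n ≡ y}
      ... | yes (m , n , p , q) = m , n , p , q , just-injective eq

      good₀ : Good d₀
      good₀ = record
        { domˡ  = coded-domˡ ∘ d₀⁻
        ; domʳ  = coded-domʳ ∘ d₀⁻
        ; cod   = coded-cod ∘ d₀⁻
        ; total = λ (_ , p) (_ , q) → coded-total (d₀⁻ p) (d₀⁻ q)
        ; inj   = λ p q → coded-injective (d₀⁻ p) (d₀⁻ q)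
        }
        where
        coded-domˡ : ∀ {x y z} → Coded x y z → dom d₀ x
        coded-domˡ (m , _ , refl , _) = _ , d₀⁺ m m
        coded-domʳ : ∀ {x y z} → Coded x y z → dom d₀ y
        coded-domʳ (_ , n , _ , refl , _) = _ , d₀⁺ n n
        coded-cod : ∀ {x y z} → Coded x y z → dom d₀ z
        coded-cod (m , n , _ , _ , refl) = _ , d₀⁺ (ℕ-pair (m , n)) (ℕ-pair (m , n))
        coded-total : ∀ {x y z w} → Coded x x z → Coded y y w → ∃ λ v → d₀ (x , y) ≡ just v
        coded-total (m , _ , refl , _) (n , _ , refl , _) = _ , d₀⁺ m n
        coded-injective : ∀ {x y x′ y′ z} → Coded x y z → Coded x′ y′ z → (x , y) ≡ (x′ , y′)
        coded-injective (m , n , refl , refl , p) (m′ , n′ , refl , refl , q)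
          with refl ← ℕ-pair-injective (m , n) (m′ , n′) (↣-injective ι (trans p (sym q))) = refl

      open Zorn Good closed d₀ good₀

    module _ (d : X × X → Maybe X) (good : Good d) (d₀⊑d : d₀ ⊑ d)
             (max : ∀ {d′} → Good d′ → d ⊑ d′ → d′ ≡ d) where
      private
        open Good good

        S Sᶜ : Set _
        S = [ x ∈ X ∣ dom d x ]
        Sᶜ = [ x ∈ X ∣ ¬ dom d x ]

        ∈S : (s : S) → dom d (value s)
        ∈S (x , [ p ]) = recompute em p

        ∉S : (s : Sᶜ) → ¬ dom d (value s)
        ∉S (x , [ p ]) = recompute em p

        pair : S × S → S
        pair (s , t) = let z , eq = total (∈S s) (∈S t) in z , [ cod eq ]

        pair-injective : Injective _≡_ _≡_ pair
        pair-injective {s , t} {s′ , t′} eq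
          with total (∈S s) (∈S t) | total (∈S s′) (∈S t′) | eq
        ... | _ , p | _ , q | refl with refl ← inj p q = refl

        bit : Bool → S
        bit false = ⟦ ι ⟧ 0 , [ _ , d₀⊑d _ (d₀⁺ 0 0) ]
        bit true = ⟦ ι ⟧ 1 , [ _ , d₀⊑d _ (d₀⁺ 1 1) ]

        bit-injective : Injective _≡_ _≡_ bit
        bit-injective {false} {false} _ = refl
        bit-injective {true} {true} _ = refl
        bit-injective {false} {true} eq = contradiction (↣-injective ι (cong value eq)) λ ()
        bit-injective {true} {false} eq = contradiction (↣-injective ι (cong value eq)) λ ()

        tag : Bool × S → S
        tag (b , s) = pair (bit b , s)

        tag-injective : ∀ u v → tag u ≡ tag v → u ≡ v
        tag-injective _ _ eq with pair-injective eq
        ... | eq′ = cong₂ _,_ (bit-injective (cong proj₁ eq′)) (cong proj₂ eq′)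

        -- If the complement is no larger than S, then X embeds into two copies of S, hence into S ×
        -- S and into S.
        small : (k : Sᶜ ↣ S) → (X × X) ↣ X
        small k = mk↣ {to = λ (x , y) → value (pair (code x , code y))} λ eq →
          let eq′ = pair-injective (value-injective eq)
          in cong₂ _,_ (code-injective (cong proj₁ eq′)) (code-injective (cong proj₂ eq′))
          where
          code : X → S
          code x with em {P = dom d x}
          ... | yes p = tag (false , (x , [ p ]))
          ... | no ¬p = tag (true , ⟦ k ⟧ (x , [ ¬p ]))

          code-injective : Injective _≡_ _≡_ code
          code-injective {x} {y} eq with em {P = dom d x} | em {P = dom d y}
          ... | yes p | yes q = cong (value ∘ proj₂) (tag-injective (false , x , [ p ]) (false , y , [ q ]) eq)
          ... | no p | no q = cong value (↣-injective k (cong proj₂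
                                (tag-injective (true , ⟦ k ⟧ (x , [ p ])) (true , ⟦ k ⟧ (y , [ q ])) eq)))
          ... | yes p | no q = contradiction
            (cong proj₁ (tag-injective (false , x , [ p ]) (true , ⟦ k ⟧ (y , [ q ])) eq)) λ ()
          ... | no p | yes q = contradiction
            (cong proj₁ (tag-injective (true , ⟦ k ⟧ (x , [ p ])) (false , y , [ q ]) eq)) λ ()

        -- Otherwise `j` gives a copy of S disjoint from S. The injection extends to the union of
        -- both: pairs not yet treated are coded in S by `tag` and `pair` and then moved by `j` into
        -- the new copy, where they cannot clash with old values. This contradicts maximality.
        module Large (j : S ↣ Sᶜ) where

          code : Bool × S → X
          code (false , s) = value s
          code (true , s) = value (⟦ j ⟧ s)

          code-injective : ∀ u v → code u ≡ code v → u ≡ v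
          code-injective (false , s) (false , t) refl = refl
          code-injective (true , s) (true , t) eq = cong (true ,_) (↣-injective j (value-injective eq))
          code-injective (false , s) (true , t) eq = contradiction (subst (dom d) eq (∈S s)) (∉S (⟦ j ⟧ t))
          code-injective (true , s) (false , t) eq = contradiction (subst (dom d) (sym eq) (∈S t)) (∉S (⟦ j ⟧ s))

          New : X × X → Set _
          New (x , y) = ∃ λ u → ∃ λ v → code u ≡ x × code v ≡ y

          new : (p : X × X) → New p → X
          new _ (u , v , _) = code (true , pair (tag u , tag v))

          new-injective : ∀ {p q} (n : New p) (m : New q) → new p n ≡ new q m → p ≡ q
          new-injective (u , v , refl , refl) (u′ , v′ , refl , refl) eq =
            let eq′ = pair-injective (cong proj₂ (code-injective (true , _) (true , _) eq))
            in cong₂ _,_ (cong code (tag-injective u u′ (cong proj₁ eq′)))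
                         (cong code (tag-injective v v′ (cong proj₂ eq′)))

          d⁺ : X × X → Maybe X
          d⁺ p with d p | em {P = New p}
          ... | just z | _ = just z
          ... | nothing | yes n = just (new p n)
          ... | nothing | no _ = nothing

          d⊑d⁺ : d ⊑ d⁺
          d⊑d⁺ p eq with d p | em {P = New p}
          ... | just z | _ = eq

          d⁺⁻ : ∀ {p z} → d⁺ p ≡ just z → d p ≡ just z ⊎ ∃ λ n → z ≡ new p n
          d⁺⁻ {p} eq with d p | em {P = New p}
          ... | just z | _ = inj₁ eq
          ... | nothing | yes n = inj₂ (n , sym (just-injective eq))

          d⁺-total : ∀ {p} → New p → ∃ λ z → d⁺ p ≡ just z
          d⁺-total {p} n with d p | em {P = New p}
          ... | just z | _ = z , refl
          ... | nothing | yes _ = _ , refl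
          ... | nothing | no ¬n = contradiction n ¬n

          coded⇒dom : ∀ {x} u → code u ≡ x → dom d⁺ x
          coded⇒dom u eq = d⁺-total (u , u , eq , eq)

          dom⇒coded : ∀ {x} → dom d⁺ x → ∃ λ u → code u ≡ x
          dom⇒coded (_ , eq) with d⁺⁻ eq
          ... | inj₁ eq′ = (false , (_ , [ domˡ eq′ ])) , refl
          ... | inj₂ ((u , _ , p , _) , _) = u , p

          dom-mono : ∀ {x} → dom d x → dom d⁺ x
          dom-mono (z , eq) = z , d⊑d⁺ _ eq

          good⁺ : Good d⁺
          good⁺ = record
            { domˡ  = λ eq → [ dom-mono ∘ domˡ , (λ ((u , _ , p , _) , _) → coded⇒dom u p) ]′ (d⁺⁻ eq)
            ; domʳ  = λ eq → [ dom-mono ∘ domʳ , (λ ((_ , v , _ , p) , _) → coded⇒dom v p) ]′ (d⁺⁻ eq)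
            ; cod   = λ eq → [ dom-mono ∘ cod , (λ (_ , p) → coded⇒dom (true , _) (sym p)) ]′ (d⁺⁻ eq)
            ; total = λ p q → let u , eq = dom⇒coded p
                                  v , eq′ = dom⇒coded q
                              in d⁺-total (u , v , eq , eq′)
            ; inj   = λ p q → separate (d⁺⁻ p) (d⁺⁻ q)
            }
            where
            separate : ∀ {p q z} → d p ≡ just z ⊎ (∃ λ n → z ≡ new p n) →
                       d q ≡ just z ⊎ (∃ λ n → z ≡ new q n) → p ≡ q
            separate (inj₁ p) (inj₁ q) = inj p q
            separate (inj₁ p) (inj₂ (_ , refl)) = contradiction (cod p) (∉S (⟦ j ⟧ _))
            separate (inj₂ (_ , refl)) (inj₁ q) = contradiction (cod q) (∉S (⟦ j ⟧ _))
            separate (inj₂ (n , refl)) (inj₂ (m , eq)) = new-injective n m eq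

          absurd : ⊥
          absurd = ∉S (⟦ j ⟧ (bit true))
            (subst (λ d → dom d (code (true , bit true))) (max good⁺ d⊑d⁺) (coded⇒dom (true , bit true) refl))

      square′ : (X × X) ↣ X
      square′ with ↣-total S Sᶜ
      ... | inj₁ j = ⊥-elim (Large.absurd j)
      ... | inj₂ k = small k

    square : (X × X) ↣ X
    square = let d , good , d₀⊑d , max = zorn in square′ d good d₀⊑d max

  ≺-max : {A B K : Set ℓ₁} → A ≺ K → B ≺ K → ∃ λ (C : Set ℓ₁) → C ≺ K × (A ↣ C) × (B ↣ C)
  ≺-max {A = A} {B} A≺K B≺K with ↣-total A B
  ... | inj₁ f = B , B≺K , f , ↣-id B
  ... | inj₂ g = A , A≺K , ↣-id A , g

  ×-↣ : {A B C : Set ℓ₁} → A ↣ C → B ↣ C → (A × B) ↣ (C × C)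
  ×-↣ f g = mk↣ {to = λ (x , y) → ⟦ f ⟧ x , ⟦ g ⟧ y} λ eq →
    cong₂ _,_ (↣-injective f (cong proj₁ eq)) (↣-injective g (cong proj₂ eq))

  -- The largest of the three sets absorbs its own square, being infinite because of `C`; `A` and
  -- `B` may both be finite.
  ×-≺ : {A B C K : Set ℓ₁} → ℕ ↣ C → A ≺ K → B ≺ K → C ≺ K → (A × B) ≺ K
  ×-≺ {A = A} {B} {C} ℕ↣C A≺K B≺K C≺K with ≺-max B≺K C≺K
  ... | D , D≺K , B↣D , C↣D with ≺-max A≺K D≺K
  ...   | E , E≺K , A↣E , D↣E =
    ≺-respˡ-↣ (Square.square (D↣E ↣-∘ (C↣D ↣-∘ ℕ↣C)) ↣-∘ ×-↣ A↣E (D↣E ↣-∘ B↣D)) E≺K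

  -- Syntax

  cast : {P Q : Set ℓ₁} → P ≡ Q → P → Q
  cast refl p = p

  ∈-catMaybes⁺ : ∀ {v : A} {xs} → just v ∈ xs → v ∈ List.catMaybes xs
  ∈-catMaybes⁺ {xs = just _ ∷ _} (here refl) = here refl
  ∈-catMaybes⁺ {xs = just _ ∷ _} (there p) = there (∈-catMaybes⁺ p)
  ∈-catMaybes⁺ {xs = nothing ∷ _} (there p) = ∈-catMaybes⁺ p

  ≔-∘ : (f : A → B) (d : V → A) {v : V} {m : A} → f ∘ (d [ v ≔ m ]) ≡ (f ∘ d) [ v ≔ f m ]
  ≔-∘ f d {v} = ext λ w → lemma w
    where
    lemma : ∀ w → f ((d [ v ≔ _ ]) w) ≡ ((f ∘ d) [ v ≔ _ ]) w
    lemma w with em {P = w ≡ v}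
    ... | yes _ = refl
    ... | no _ = refl

  module _ {ℓ : Level} {L : Language ℓ} where

    renameᵗ : (V → A) → Term L V → Term L A
    renameᵗ r (var x) = var (r x)
    renameᵗ r (app f ts) = app f (λ k → renameᵗ r (ts k))

    rename : (V → A) → Formula L V → Formula L A
    rename r ⊥′ = ⊥′
    rename r (s ≈′ t) = renameᵗ r s ≈′ renameᵗ r t
    rename r (rel′ R ts) = rel′ R (λ k → renameᵗ r (ts k))
    rename r (φ ⇒′ ψ) = rename r φ ⇒′ rename r ψ
    rename r (∀′ φ) = ∀′ rename (Maybe.map r) φ

    rename-QuantifierFree : (r : V → A) {φ : Formula L V} → QuantifierFree φ → QuantifierFree (rename r φ)
    rename-QuantifierFree r ⊥′ = ⊥′
    rename-QuantifierFree r (s ≈′ t) = _ ≈′ _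
    rename-QuantifierFree r (rel′ R ts) = rel′ R _
    rename-QuantifierFree r (p ⇒′ q) = rename-QuantifierFree r p ⇒′ rename-QuantifierFree r q

    fvᵗ : Term L V → List V
    fvᵗ (var x) = x ∷ []
    fvᵗ (app f ts) = List.concat (List.tabulate λ k → fvᵗ (ts k))

    fv : Formula L V → List V
    fv ⊥′ = []
    fv (s ≈′ t) = fvᵗ s ++ fvᵗ t
    fv (rel′ R ts) = List.concat (List.tabulate λ k → fvᵗ (ts k))
    fv (φ ⇒′ ψ) = fv φ ++ fv ψ
    fv (∀′ φ) = List.catMaybes (fv φ)

    -- ∃y φ, with y kept in the variable context so that the operation can be iterated.
    ex : V → Formula L V → Formula L V
    ex y φ = ¬′ (∀′ (¬′ rename (just [ y ≔ nothing ]) φ))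

    exs : List V → Formula L V → Formula L V
    exs ys φ = List.foldr ex φ ys

    -- A negated finite conjunction, written with the available connectives; the conjunction itself
    -- is `¬′ refute Γ is`.
    refute : {I : Set ℓ₄} → (I → Formula L V) → List I → Formula L V
    refute Γ = List.foldr (λ i φ → Γ i ⇒′ φ) ⊥′

    module _ (M : Structure L) where

      eval-rename : (ρ : A → Carrier M) (r : V → A) (t : Term L V) →
                    eval M ρ (renameᵗ r t) ≡ eval M (ρ ∘ r) t
      eval-rename ρ r (var x) = refl
      eval-rename ρ r (app f ts) = cong (func M f) (ext λ k → eval-rename ρ r (ts k))

      Sat-rename : (ρ : A → Carrier M) (r : V → A) (φ : Formula L V) →
                   Sat M ρ (rename r φ) ≡ Sat M (ρ ∘ r) φ
      Sat-rename ρ r ⊥′ = refl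
      Sat-rename ρ r (s ≈′ t) = cong₂ _≡_ (eval-rename ρ r s) (eval-rename ρ r t)
      Sat-rename ρ r (rel′ R ts) = cong (rel M R) (ext λ k → eval-rename ρ r (ts k))
      Sat-rename ρ r (φ ⇒′ ψ) = cong₂ (λ P Q → P → Q) (Sat-rename ρ r φ) (Sat-rename ρ r ψ)
      Sat-rename ρ r (∀′ φ) = cong (λ P → ∀ x → P x) (ext λ x →
        trans (Sat-rename (maybe′ ρ x) (Maybe.map r) φ)
              (cong (λ σ → Sat M σ φ) (ext λ { (just v) → refl ; nothing → refl })))

      eval-local : {ρ σ : V → Carrier M} (t : Term L V) → (∀ {v} → v ∈ fvᵗ t → ρ v ≡ σ v) →
                   eval M ρ t ≡ eval M σ t
      eval-local (var x) eq = eq (here refl)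
      eval-local (app f ts) eq = cong (func M f) (ext λ k →
        eval-local (ts k) λ v∈ → eq (∈-concat⁺′ v∈ (∈-tabulate⁺ k)))

      Sat-local : {ρ σ : V → Carrier M} (φ : Formula L V) → (∀ {v} → v ∈ fv φ → ρ v ≡ σ v) →
                  Sat M ρ φ ≡ Sat M σ φ
      Sat-local ⊥′ eq = refl
      Sat-local (s ≈′ t) eq = cong₂ _≡_ (eval-local s (eq ∘ ∈-++⁺ˡ)) (eval-local t (eq ∘ ∈-++⁺ʳ (fvᵗ s)))
      Sat-local (rel′ R ts) eq = cong (rel M R) (ext λ k →
        eval-local (ts k) λ v∈ → eq (∈-concat⁺′ v∈ (∈-tabulate⁺ k)))
      Sat-local (φ ⇒′ ψ) eq =
        cong₂ (λ P Q → P → Q) (Sat-local φ (eq ∘ ∈-++⁺ˡ)) (Sat-local ψ (eq ∘ ∈-++⁺ʳ (fv φ)))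
      Sat-local (∀′ φ) eq = cong (λ P → ∀ x → P x) (ext λ x →
        Sat-local φ λ { {just v} v∈ → eq (∈-catMaybes⁺ v∈) ; {nothing} _ → refl })

      Sat-ex : (ρ : V → Carrier M) {y : V} {x : Carrier M} (φ : Formula L V) →
               Sat M (maybe′ ρ x) (rename (just [ y ≔ nothing ]) φ) ≡ Sat M (ρ [ y ≔ x ]) φ
      Sat-ex ρ {y} {x} φ = trans (Sat-rename (maybe′ ρ x) (just [ y ≔ nothing ]) φ)
                                 (cong (λ σ → Sat M σ φ) (≔-∘ (maybe′ ρ x) just))

      exs⁺ : ∀ {ρ σ : V → Carrier M} ys (φ : Formula L V) →
             (∀ {v} → v ∈ fv φ → v ∉ ys → σ v ≡ ρ v) → Sat M σ φ → Sat M ρ (exs ys φ)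
      exs⁺ [] φ eq sat = cast (Sat-local φ λ v∈ → eq v∈ λ ()) sat
      exs⁺ {ρ = ρ} {σ} (y ∷ ys) φ eq sat none = none (σ y) (cast (sym (Sat-ex ρ (exs ys φ)))
        (exs⁺ ys φ (λ {v} v∈ v∉ → ≔-elim ρ (λ v m → v ∈ fv φ → v ∉ ys → σ v ≡ m) (λ _ _ → refl)
          (λ w w≢y w∈ w∉ → eq w∈ λ { (here w≡y) → w≢y w≡y ; (there w∈ys) → w∉ w∈ys }) v v∈ v∉) sat))

      exs⁻ : ∀ {ρ : V → Carrier M} ys (φ : Formula L V) → Sat M ρ (exs ys φ) →
             ∃ λ σ → (∀ v → v ∉ ys → σ v ≡ ρ v) × Sat M σ φ
      exs⁻ {ρ = ρ} [] φ sat = ρ , (λ _ _ → refl) , sat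
      exs⁻ {ρ = ρ} (y ∷ ys) φ sat =
        let x , sat′ = by-contradiction {A = ∃ λ x → Sat M (ρ [ y ≔ x ]) (exs ys φ)} λ ¬x →
              lower (sat λ x p → ⊥-elim (¬x (x , cast (Sat-ex ρ (exs ys φ)) p)))
            σ , eq , p = exs⁻ ys φ sat′
        in σ , (λ v v∉ → trans (eq v (v∉ ∘ there)) (≔-other ρ λ v≡y → v∉ (here v≡y))) , p

      refute⁺ : {I : Set ℓ₄} (Γ : I → Formula L V) {ρ : V → Carrier M} → ∀ is →
                ¬ All (Sat M ρ ∘ Γ) is → Sat M ρ (refute Γ is)
      refute⁺ Γ [] ¬all = lift (¬all [])
      refute⁺ Γ (i ∷ is) ¬all p = refute⁺ Γ is λ ps → ¬all (p ∷ ps)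

      refute⁻ : {I : Set ℓ₄} (Γ : I → Formula L V) {ρ : V → Carrier M} → ∀ {is} →
                Sat M ρ (refute Γ is) → ¬ All (Sat M ρ ∘ Γ) is
      refute⁻ Γ sat [] = lower sat
      refute⁻ Γ sat (p ∷ ps) = refute⁻ Γ (sat p) ps

  -- Realising types in many variables in a saturated structure

  module Realisation {ℓ : Level} {L : Language ℓ} (M : Structure L) {K : Set ℓ} (saturated : Saturated K M)
    {V I : Set ℓ} (V≺K : V ≺ K) (Γ : I → Formula L V)
    (finitely-satisfiable : ∀ is → ∃ λ (ρ : V → Carrier M) → All (Sat M ρ ∘ Γ) is) where

    private
      vars : List I → List V
      vars = List.concatMap (fv ∘ Γ)

      All-local : {ρ σ : V → Carrier M} → ∀ is → (∀ {v} → v ∈ vars is → ρ v ≡ σ v) →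
                  All (Sat M ρ ∘ Γ) is → All (Sat M σ ∘ Γ) is
      All-local [] eq [] = []
      All-local (i ∷ is) eq (p ∷ ps) =
        cast (Sat-local M (Γ i) (eq ∘ ∈-++⁺ˡ)) p ∷ All-local is (eq ∘ ∈-++⁺ʳ (fv (Γ i))) ps

      _Extends_ : (V → Carrier M) → (V → Maybe (Carrier M)) → Set ℓ
      ρ Extends d = ∀ {v m} → d v ≡ just m → ρ v ≡ m

      -- Finite satisfiability of `Γ` once the values of `d` are fixed as parameters. `Saturated`
      -- handles one further variable, and a maximal such `d` handles them all.
      Good : (V → Maybe (Carrier M)) → Set ℓ
      Good d = ∀ is → ∃ λ ρ → ρ Extends d × All (Sat M ρ ∘ Γ) is

      closed : ∀ u → (∀ F → ∃ λ d → Good d × (∀ {v} → v ∈ F → d v ≡ u v)) → Good u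
      closed u approx is =
        let d , good , d≡u = approx (vars is)
            ρ , ρ⊒d , sat = good is
        in (λ v → fromMaybe (ρ v) (u v)) , (λ uv → cong (fromMaybe _) uv) ,
           All-local is (λ {v} v∈ → agree (u v) λ uv → ρ⊒d (trans (d≡u v∈) uv)) sat
        where
        agree : ∀ {x : Carrier M} m → (∀ {y} → m ≡ just y → x ≡ y) → x ≡ fromMaybe x m
        agree (just y) eq = eq refl
        agree nothing eq = refl

      empty-Good : Good (λ _ → nothing)
      empty-Good is = let ρ , sat = finitely-satisfiable is in ρ , (λ ()) , sat

      open Zorn Good closed (λ _ → nothing) empty-Good

      module Extend (d : V → Maybe (Carrier M)) (good : Good d) {v : V} (dv : d v ≡ nothing) where

        c : V → Carrier M
        -- The default only makes `c` total: `r` refers to parameters solely where `d` is defined.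
        c u = fromMaybe (proj₁ (good []) u) (d u)

        r : V → Maybe V
        r u = Maybe.map (λ _ → u) (d u)

        free : List I → List V
        free is = List.filter (λ u → em {P = d u ≡ nothing × u ≢ v}) (vars is)

        conjunction : List I → Formula L V
        conjunction is = ¬′ refute Γ is

        body : List I → Formula L V
        body is = exs (free is) (conjunction is)

        -- The condition on a value `x` for `v` that some assignment extending `d` with `x` at `v`
        -- satisfies `Γ` on `is`. All undefined variables are sent to `nothing` by `r`, but those
        -- other than `v` that occur are already bound by `exs`.
        ψ : List I → Formula L (Maybe V)
        ψ is = rename r (body is)

        c∘r-defined : ∀ {u m x} → d u ≡ just m → maybe′ c x (r u) ≡ m
        c∘r-defined {u} eq = trans (cong (maybe′ c _ ∘ Maybe.map (λ _ → u)) eq) (cong (fromMaybe _) eq)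

        c∘r-undefined : ∀ {u x} → d u ≡ nothing → maybe′ c x (r u) ≡ x
        c∘r-undefined {u} eq = cong (maybe′ c _ ∘ Maybe.map (λ _ → u)) eq

        ψ⁺ : ∀ {ρ} is → ρ Extends d → All (Sat M ρ ∘ Γ) is → Sat M (maybe′ c (ρ v)) (ψ is)
        ψ⁺ {ρ} is ρ⊒d sat = cast (sym (Sat-rename M (maybe′ c (ρ v)) r (body is)))
          (exs⁺ M (free is) (conjunction is) (λ {u} u∈ u∉ → agree u (∈-vars is u∈) u∉ (d u) refl)
            (λ ref → lift (refute⁻ M Γ ref sat)))
          where
          ∈-vars : ∀ {u} is → u ∈ fv (conjunction is) → u ∈ vars is
          ∈-vars {u} is u∈ = go is (subst (u ∈_) (++-identityʳ (fv (refute Γ is))) u∈)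
            where
            go : ∀ is → u ∈ fv (refute Γ is) → u ∈ vars is
            go (i ∷ is) u∈ with ∈-++⁻ (fv (Γ i)) u∈
            ... | inj₁ p = ∈-++⁺ˡ p
            ... | inj₂ p = ∈-++⁺ʳ (fv (Γ i)) (go is p)

          agree : ∀ u → u ∈ vars is → u ∉ free is → ∀ x → d u ≡ x → ρ u ≡ maybe′ c (ρ v) (r u)
          agree u u∈ u∉ (just m) eq = trans (ρ⊒d eq) (sym (c∘r-defined eq))
          agree u u∈ u∉ nothing eq = trans (cong ρ (by-contradiction λ u≢v →
            u∉ (∈-filter⁺ (λ _ → em) u∈ (eq , u≢v)))) (sym (c∘r-undefined eq))

        ψ⁻ : ∀ {x} is → Sat M (maybe′ c x) (ψ is) →
             ∃ λ ρ → ρ Extends (d [ v ≔ just x ]) × All (Sat M ρ ∘ Γ) is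
        ψ⁻ {x} is sat =
          let ρ , eq , p = exs⁻ M (free is) (conjunction is) (cast (Sat-rename M (maybe′ c x) r (body is)) sat)
          in ρ ,
             (λ {u} {m} → ≔-elim d (λ u k → k ≡ just m → ρ u ≡ m)
               (λ { refl → trans (eq v (λ v∈ → proj₂ (proj₂ (∈-filter⁻ (λ _ → em) {xs = vars is} v∈)) refl))
                                 (c∘r-undefined dv) })
               (λ w w≢v dw → trans (eq w λ w∈ → contradiction
                 (trans (sym dw) (proj₁ (proj₂ (∈-filter⁻ (λ _ → em) {xs = vars is} w∈)))) λ ())
                 (c∘r-defined dw)) u) ,
             by-contradiction λ ¬sat → lower (p (refute⁺ M Γ is ¬sat))

        p : Pred (Formula L (Maybe V)) ℓ
        p φ = ∃ λ is → ψ is ≡ φ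

        indices : ∀ {Δ} → All p Δ → List I
        indices [] = []
        indices ((is , _) ∷ ps) = is ++ indices ps

        p-satisfied : ∀ {ρ Δ} (ps : All p Δ) → ρ Extends d → All (Sat M ρ ∘ Γ) (indices ps) →
                      All (Sat M (maybe′ c (ρ v))) Δ
        p-satisfied [] ρ⊒d sat = []
        p-satisfied ((is , refl) ∷ ps) ρ⊒d sat =
          ψ⁺ is ρ⊒d (++⁻ˡ is sat) ∷ p-satisfied ps ρ⊒d (++⁻ʳ is sat)

        extend : ∃ λ x → Good (d [ v ≔ just x ])
        extend =
          let x , realised = saturated V V≺K c p λ Δ ps →
                let ρ , ρ⊒d , sat = good (indices ps) in ρ v , p-satisfied ps ρ⊒d sat
          in x , λ is → ψ⁻ is (realised (is , refl))

    realise : ∃ λ (ρ : V → Carrier M) → ∀ i → Sat M ρ (Γ i)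
    realise =
      let d , good , _ , max = zorn
          ρ , d≡ρ = maximal⇒total {Good = Good} max (Extend.extend d good)
      in ρ , λ i → let σ , σ⊒d , sat = good (i ∷ [])
                   in cast (cong (λ τ → Sat M τ (Γ i)) (ext λ v → σ⊒d (d≡ρ v))) (All.head sat)

  -- Quantifier-free types and ages

  qftp-∘ : ∀ {ℓ} {L : Language ℓ} (M N : Structure L) {i : V → Carrier M} {j : V → Carrier N} →
           qftp M i ≐ qftp N j → (r : A → V) → qftp M (i ∘ r) ≐ qftp N (j ∘ r)
  qftp-∘ M N (p , q) r =
    (λ {φ} (qf , sat) → qf , cast (Sat-rename N _ r φ)
      (proj₂ (p (rename-QuantifierFree r qf , cast (sym (Sat-rename M _ r φ)) sat)))) ,
    (λ {φ} (qf , sat) → qf , cast (Sat-rename M _ r φ)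
      (proj₂ (q (rename-QuantifierFree r qf , cast (sym (Sat-rename N _ r φ)) sat))))

  qftp-≡ : ∀ {ℓ} {L : Language ℓ} (M N : Structure L) {i : V → Carrier M} {j : V → Carrier N} →
           qftp M i ≐ qftp N j → ∀ {k l} → i k ≡ i l → j k ≡ j l
  qftp-≡ M N (p , _) {k} {l} eq = proj₂ (p (var k ≈′ var l , eq))

  ↔-to-injective : (f : A ↔ B) → Injective _≡_ _≡_ (Inverse.to f)
  ↔-to-injective f {x} {y} eq = trans (sym (Inverse.strictlyInverseʳ f x))
    (trans (cong (Inverse.from f) eq) (Inverse.strictlyInverseʳ f y))

  ↔-from-injective : (f : A ↔ B) → Injective _≡_ _≡_ (Inverse.from f)
  ↔-from-injective f {x} {y} eq = trans (sym (Inverse.strictlyInverseˡ f x))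
    (trans (cong (Inverse.to f) eq) (Inverse.strictlyInverseˡ f y))

  module _ {ℓ : Level} {L : Language ℓ} (M N : Structure L) {n : ℕ} {g : Vector (Carrier N) n}
           (M≅⟨g⟩ : M ≅ ⟨_⟩ N g) where

    private module ≅ = _≅_ M≅⟨g⟩

    embed : Carrier M → Carrier N
    embed x = value (≅.to x)

    embed-injective : ∀ {x y} → embed x ≡ embed y → x ≡ y
    embed-injective eq = ↔-to-injective ≅.bijection (value-injective eq)

    eval-embed : (ρ : V → Carrier M) (t : Term L V) → embed (eval M ρ t) ≡ eval N (embed ∘ ρ) t
    eval-embed ρ (var x) = refl
    eval-embed ρ (app f ts) =
      trans (cong value (≅.func-homo f _)) (cong (func N f) (ext λ k → eval-embed ρ (ts k)))

    Sat-embed : (ρ : V → Carrier M) {φ : Formula L V} → QuantifierFree φ →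
                Sat M ρ φ ⇔ Sat N (embed ∘ ρ) φ
    Sat-embed ρ ⊥′ = ⇔-id _
    Sat-embed ρ (s ≈′ t) = mk⇔
      (λ eq → trans (sym (eval-embed ρ s)) (trans (cong embed eq) (eval-embed ρ t)))
      (λ eq → embed-injective (trans (eval-embed ρ s) (trans eq (sym (eval-embed ρ t)))))
    Sat-embed ρ (rel′ R ts) =
      subst (λ xs → rel M R (λ k → eval M ρ (ts k)) ⇔ rel N R xs) (ext λ k → eval-embed ρ (ts k)) (≅.rel-iso R _)
    Sat-embed ρ (p ⇒′ q) = mk⇔
      (λ f x → Equivalence.to (Sat-embed ρ q) (f (Equivalence.from (Sat-embed ρ p) x)))
      (λ f x → Equivalence.from (Sat-embed ρ q) (f (Equivalence.to (Sat-embed ρ p) x)))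

    qftp-embed : (ρ : V → Carrier M) → qftp M ρ ≐ qftp N (embed ∘ ρ)
    qftp-embed ρ = (λ (qf , sat) → qf , Equivalence.to (Sat-embed ρ qf) sat) ,
                   (λ (qf , sat) → qf , Equivalence.from (Sat-embed ρ qf) sat)

  ≅-refl : ∀ {ℓ} {L : Language ℓ} {M : Structure L} → M ≅ M
  ≅-refl = record { bijection = ↔-id _ ; func-homo = λ _ _ → refl ; rel-iso = λ _ _ → ⇔-id _ }

  enumerate : {X : Set ℓ₁} (xs : List X) → Σ[ C ∈ FiniteSubset X ]
              (∀ k → elements C k ∈ xs) × (∀ {x} → x ∈ xs → ∃ λ k → elements C k ≡ x)
  enumerate [] = record { size = 0 ; enumeration = mk↣ {to = λ ()} λ { {()} } } , (λ ()) , λ ()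
  enumerate (x ∷ xs) with enumerate xs
  ... | C , sound , complete with em {P = ∃ λ k → elements C k ≡ x}
  ...   | yes found = C , there ∘ sound , λ { (here refl) → found ; (there p) → complete p }
  ...   | no new = record { size = suc (size C) ; enumeration = mk↣ {to = to} to-injective } ,
                   (λ { zero → here refl ; (suc k) → there (sound k) }) ,
                   (λ { (here refl) → zero , refl ; (there p) → let k , eq = complete p in suc k , eq })
    where
    to : Fin (suc (size C)) → _
    to zero = x
    to (suc k) = elements C k
    to-injective : ∀ {k l} → to k ≡ to l → k ≡ l
    to-injective {zero} {zero} eq = refl
    to-injective {zero} {suc l} eq = contradiction (l , sym eq) new
    to-injective {suc k} {zero} eq = contradiction (k , eq) new
    to-injective {suc k} {suc l} eq = cong suc (↣-injective (enumeration C) eq)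

  -- Ramsey properties for tuples and for finite subsets.

  module _ {ℓ : Level} {L : Language ℓ} (N : Structure L) where

    generated-subset : ∀ {n} {g : Vector (Carrier N) n} (C : FiniteSubset (Carrier N)) →
                       (∀ k → Closure N g (elements C k)) → FiniteSubset (Carrier (⟨_⟩ N g))
    generated-subset C closure = record
      { size = size C
      ; enumeration = mk↣ {to = λ k → elements C k , [ closure k ]} λ eq →
          ↣-injective (enumeration C) (cong value eq)
      }

    Within : ∀ {n} → List (Carrier N) → Vector (Carrier N) n → Set ℓ
    Within B i = ∀ k → i k ∈ B

    EmbedsOn : List (Carrier N) → (Carrier N → Carrier N) → Set ℓ
    EmbedsOn B e = ∀ {m} (i : Vector (Carrier N) m) → Within B i → qftp N (e ∘ i) ≐ qftp N i

    ConstantOn : ∀ {n} → List (Carrier N) → Vector (Carrier N) n →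
                 (Vector (Carrier N) n → Bool) → (Carrier N → Carrier N) → Set ℓ
    ConstantOn B α χ e = ∀ i j → Within B i → Within B j →
      qftp N (e ∘ i) ≐ qftp N α → qftp N (e ∘ j) ≐ qftp N α → χ (e ∘ i) ≡ χ (e ∘ j)

    -- The Ramsey property for tuples of N itself, with copies of B given by
    -- maps defined on all of N; α may have repetitions.
    TupleERP : Set ℓ
    TupleERP = ∀ {n} (α : Vector (Carrier N) n) (B : List (Carrier N)) → ∃ λ (C : List (Carrier N)) →
      ∀ (χ : Vector (Carrier N) n → Bool) → ∃ λ (e : Carrier N → Carrier N) →
      (∀ {x} → x ∈ B → e x ∈ C) × EmbedsOn B e × ConstantOn B α χ e

    -- Repetitions in `α` and `B` are removed by enumeration, with `s` and `σ` translating between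
    -- `α` and its set of entries; a colouring of tuples is pulled back to copies along `s`.
    FinitaryERP⇒TupleERP : FinitaryERP N → TupleERP
    FinitaryERP⇒TupleERP erp {n} α B = List.tabulate γ , λ χ → Homogeneous-copy.result χ
      where
      A₀ = enumerate (List.tabulate α)
      B₀ = enumerate B

      α₀ = elements (proj₁ A₀)
      β₀ = elements (proj₁ B₀)

      s : Fin n → Fin (size (proj₁ A₀))
      s k = proj₁ (proj₂ (proj₂ A₀) (∈-tabulate⁺ {f = α} k))

      σ : Fin (size (proj₁ A₀)) → Fin n
      σ k = proj₁ (∈-tabulate⁻ {f = α} (proj₁ (proj₂ A₀) k))

      α∘σ≡α₀ : α ∘ σ ≡ α₀
      α∘σ≡α₀ = ext λ k → sym (proj₂ (∈-tabulate⁻ {f = α} (proj₁ (proj₂ A₀) k)))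

      α∘σ∘s : ∀ k → α (σ (s k)) ≡ α k
      α∘σ∘s k = trans (cong-app α∘σ≡α₀ (s k)) (proj₂ (proj₂ (proj₂ A₀) (∈-tabulate⁺ {f = α} k)))

      gens = α₀ Vector.++ β₀
      M = ⟨_⟩ N gens

      A′ : FiniteSubset (Carrier M)
      A′ = generated-subset (proj₁ A₀) λ k → subst (Closure N gens) (lookup-++ˡ α₀ β₀ k) (gen (k ↑ˡ _))

      B′ : FiniteSubset (Carrier M)
      B′ = generated-subset (proj₁ B₀) λ k → subst (Closure N gens) (lookup-++ʳ α₀ β₀ k) (gen (_ ↑ʳ k))

      ramsey = erp M (_ , gens , ≅-refl) A′ B′

      N′ = proj₁ ramsey
      N′≅ = proj₂ (proj₂ (proj₁ (proj₂ ramsey)))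
      C = proj₁ (proj₂ (proj₂ ramsey))

      γ : Fin (size C) → Carrier N
      γ k = embed N′ N N′≅ (elements C k)

      module Homogeneous-copy (χ : Vector (Carrier N) n → Bool) where

        χ′ : Copy {M = M} {N = N′} C A′ → Fin 2
        χ′ f = Inverse.from 2↔Bool (χ (γ ∘ value f ∘ s))

        homogeneous = proj₂ (proj₂ (proj₂ ramsey)) χ′

        copy = value (proj₁ homogeneous)

        e : Carrier N → Carrier N
        e x with em {P = ∃ λ l → β₀ l ≡ x}
        ... | yes (l , _) = γ (copy l)
        -- The value is immaterial here, since only tuples within `B` are tested.
        ... | no _ = x

        e∘β₀ : e ∘ β₀ ≡ γ ∘ copy
        e∘β₀ = ext λ l → lemma l
          where
          lemma : ∀ l → e (β₀ l) ≡ γ (copy l)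
          lemma l with em {P = ∃ λ k → β₀ k ≡ β₀ l}
          ... | yes (k , eq) = cong (γ ∘ copy) (↣-injective (enumeration (proj₁ B₀)) eq)
          ... | no ¬p = contradiction (l , refl) ¬p

        copy-qftp : qftp N (γ ∘ copy) ≐ qftp N β₀
        copy-qftp with proj₁ homogeneous
        ... | f , [ p ] = ≐-trans (≐-sym (qftp-embed N′ N N′≅ _))
                            (≐-trans (recompute em p) (qftp-embed M N ≅-refl _))

        position : ∀ {m} {i : Vector (Carrier N) m} → Within B i → ∃ λ l → β₀ ∘ l ≡ i
        position within = (λ k → proj₁ (proj₂ (proj₂ B₀) (within k))) ,
                          ext λ k → proj₂ (proj₂ (proj₂ B₀) (within k))

        embeds : EmbedsOn B e
        embeds i within with position within
        ... | l , refl = subst (λ h → qftp N (h ∘ l) ≐ qftp N (β₀ ∘ l)) (sym e∘β₀)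
                           (qftp-∘ N N copy-qftp l)

        module _ {l : Fin n → Fin (size (proj₁ B₀))} (eq : qftp N (γ ∘ copy ∘ l) ≐ qftp N α) where

          restriction : Copy {M = M} {N = N′} C A′
          restriction = copy ∘ l ∘ σ , [ ≐-trans (qftp-embed N′ N N′≅ _)
            (≐-trans (subst (λ h → qftp N (γ ∘ copy ∘ l ∘ σ) ≐ qftp N h) α∘σ≡α₀ (qftp-∘ N N eq σ))
                     (≐-sym (qftp-embed M N ≅-refl _))) ]

          -- Going through `σ ∘ s` may replace a position of `α` by another one with the same entry.
          -- Equalities between entries belong to the quantifier-free type, so a tuple of the type
          -- of `α` is not changed.
          χ-restriction : χ′ restriction ≡ Inverse.from 2↔Bool (χ (γ ∘ copy ∘ l))
          χ-restriction = cong (Inverse.from 2↔Bool ∘ χ)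
            (ext λ k → qftp-≡ N N (≐-sym eq) (α∘σ∘s k))

        constant : ∀ (l l′ : Fin n → Fin (size (proj₁ B₀))) → qftp N (γ ∘ copy ∘ l) ≐ qftp N α →
                   qftp N (γ ∘ copy ∘ l′) ≐ qftp N α → χ (γ ∘ copy ∘ l) ≡ χ (γ ∘ copy ∘ l′)
        constant l l′ p p′ = ↔-from-injective 2↔Bool (trans (sym (χ-restriction p))
          (trans (proj₂ homogeneous (restriction p) (restriction p′)
                   (λ k → l (σ k) , refl) (λ k → l′ (σ k) , refl))
                 (χ-restriction p′)))

        result : ∃ λ e → (∀ {x} → x ∈ B → e x ∈ List.tabulate γ) × EmbedsOn B e × ConstantOn B α χ e
        result = e , into , embeds , λ i j wi wj p q → const (position wi) (position wj) p q
          where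
          into : ∀ {x} → x ∈ B → e x ∈ List.tabulate γ
          into x∈B with proj₂ (proj₂ B₀) x∈B
          ... | l , refl = subst (_∈ List.tabulate γ) (sym (cong-app e∘β₀ l)) (∈-tabulate⁺ (copy l))
          const : ∀ {i j} → (∃ λ l → β₀ ∘ l ≡ i) → (∃ λ l → β₀ ∘ l ≡ j) →
                  qftp N (e ∘ i) ≐ qftp N α → qftp N (e ∘ j) ≐ qftp N α → χ (e ∘ i) ≡ χ (e ∘ j)
          const (l , refl) (l′ , refl) p q =
            subst (λ h → χ (h ∘ l) ≡ χ (h ∘ l′)) (sym e∘β₀)
              (constant l l′ (subst (λ h → qftp N (h ∘ l) ≐ qftp N α) e∘β₀ p)
                             (subst (λ h → qftp N (h ∘ l′) ≐ qftp N α) e∘β₀ q))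

  module _ {ℓ : Level} {L : Language ℓ} (N : Structure L) where

    -- The finite set obtained for the images of `A` and `B` in `N` generates the required member of
    -- the age; quantifier-free types are the same in it and in `N`.
    TupleERP⇒FinitaryERP : TupleERP N → FinitaryERP N
    TupleERP⇒FinitaryERP erp M (_ , _ , M≅) A B =
      N′ , (_ , elements C₀ , ≅-refl) , C , arrow
      where
      α = embed M N M≅ ∘ elements A
      β = embed M N M≅ ∘ elements B

      ramsey = erp α (List.tabulate β)

      C₀ = proj₁ (enumerate (proj₁ ramsey))
      complete = proj₂ (proj₂ (enumerate (proj₁ ramsey)))

      N′ = ⟨_⟩ N (elements C₀)

      C : FiniteSubset (Carrier N′)
      C = generated-subset N C₀ gen

      qftp-C : ∀ {m} (h : Fin m → Fin (size C)) → qftp N′ (elements C ∘ h) ≐ qftp N (elements C₀ ∘ h)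
      qftp-C h = qftp-embed N′ N ≅-refl (elements C ∘ h)

      arrow : _⟶⟨_⟩^_ {M = M} {N = N′} C B A
      arrow χ = (copy , [ copy-qftp ]) , constant
        where
        χ′ : Vector (Carrier N) (size A) → Bool
        χ′ w with em {P = ∃ λ (f : Copy {M = M} {N = N′} C A) → elements C₀ ∘ value f ≡ w}
        ... | yes (f , _) = Inverse.to 2↔Bool (χ f)
        -- Tuples that are not copies get an arbitrary colour; only copies are compared in
        -- `constant`.
        ... | no _ = false

        χ′-copy : ∀ f → χ′ (elements C₀ ∘ value f) ≡ Inverse.to 2↔Bool (χ f)
        χ′-copy f with em {P = ∃ λ (h : Copy {M = M} {N = N′} C A) →
                               elements C₀ ∘ value h ≡ elements C₀ ∘ value f}
        ... | yes (h , eq) = cong (Inverse.to 2↔Bool ∘ χ)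
                (value-injective (ext λ k → ↣-injective (enumeration C₀) (cong-app eq k)))
        ... | no ¬p = contradiction (f , refl) ¬p

        e = proj₁ (proj₂ ramsey χ′)
        into = proj₁ (proj₂ (proj₂ ramsey χ′))
        embeds = proj₁ (proj₂ (proj₂ (proj₂ ramsey χ′)))
        constant-on = proj₂ (proj₂ (proj₂ (proj₂ ramsey χ′)))

        copy : Fin (size B) → Fin (size C)
        copy l = proj₁ (complete (into (∈-tabulate⁺ {f = β} l)))

        C₀∘copy : elements C₀ ∘ copy ≡ e ∘ β
        C₀∘copy = ext λ l → proj₂ (complete (into (∈-tabulate⁺ {f = β} l)))

        copy-qftp : qftp N′ (elements C ∘ copy) ≐ qftp M (elements B)
        copy-qftp = ≐-trans (qftp-C copy)
          (≐-trans (subst (λ h → qftp N h ≐ qftp N β) (sym C₀∘copy) (embeds β (∈-tabulate⁺ {f = β})))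
                   (≐-sym (qftp-embed M N M≅ (elements B))))

        module _ (f : Copy {M = M} {N = N′} C A) (image : ∀ k → ∃ λ l → value f k ≡ copy l) where

          preimage : Fin (size A) → Carrier N
          preimage k = β (proj₁ (image k))

          e∘preimage : e ∘ preimage ≡ elements C₀ ∘ value f
          e∘preimage = ext λ k → trans (sym (cong-app C₀∘copy (proj₁ (image k))))
                                       (cong (elements C₀) (sym (proj₂ (image k))))

          preimage-qftp : qftp N (e ∘ preimage) ≐ qftp N α
          preimage-qftp = subst (λ h → qftp N h ≐ qftp N α) (sym e∘preimage)
            (≐-trans (≐-sym (qftp-C (value f))) (≐-trans (copy-of f) (qftp-embed M N M≅ (elements A))))
            where
            copy-of : (f : Copy {M = M} {N = N′} C A) → qftp N′ (elements C ∘ value f) ≐ qftp M (elements A)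
            copy-of (f , [ p ]) = recompute em p

          χ′-preimage : χ′ (e ∘ preimage) ≡ Inverse.to 2↔Bool (χ f)
          χ′-preimage = trans (cong χ′ e∘preimage) (χ′-copy f)

        constant : ∀ f f′ → (∀ k → ∃ λ l → value f k ≡ copy l) →
                   (∀ k → ∃ λ l → value f′ k ≡ copy l) → χ f ≡ χ f′
        constant f f′ im im′ = ↔-to-injective 2↔Bool (trans (sym (χ′-preimage f im)) (trans
          (constant-on (preimage f im) (preimage f′ im′)
            (λ k → ∈-tabulate⁺ {f = β} (proj₁ (im k))) (λ k → ∈-tabulate⁺ {f = β} (proj₁ (im′ k)))
            (preimage-qftp f im) (preimage-qftp f′ im′))
          (χ′-preimage f′ im′)))

    Colouring : Set ℓ
    Colouring = ∃ λ n → Vector (Carrier N) n × (Vector (Carrier N) n → Bool)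

    -- The set `C` does not depend on the colouring, so the remaining colourings can first be made
    -- constant on `C` by `e′`. The first one is then read through `e′` on tuples of `C`, and what
    -- `e′` achieved on `C` is inherited by `e`, which maps `B` into `C`.
    simultaneous : TupleERP N → (B : List (Carrier N)) (Ξ : List Colouring) →
                   ∃ λ e → EmbedsOn N B e × All (λ (_ , α , χ) → ConstantOn N B α χ e) Ξ
    simultaneous erp B [] = id , (λ _ _ → ≐-refl) , []
    simultaneous erp B ((_ , α , χ) ∷ Ξ) =
      let C , ramsey = erp α B
          e′ , embeds′ , constant′ = simultaneous erp C Ξ
          e , into , embeds , constant = ramsey (λ w → χ (e′ ∘ w))
          step : ∀ {m} (i : Vector (Carrier N) m) → Within N B i → qftp N (e′ ∘ e ∘ i) ≐ qftp N (e ∘ i)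
          step i wi = embeds′ (e ∘ i) (into ∘ wi)
      in e′ ∘ e , (λ i wi → ≐-trans (step i wi) (embeds i wi)) ,
         (λ i j wi wj p q → constant i j wi wj (≐-trans (≐-sym (step i wi)) p) (≐-trans (≐-sym (step j wj)) q)) ∷
         All.map (λ {_} const i j wi wj → const (e ∘ i) (e ∘ j) (into ∘ wi) (into ∘ wj)) constant′

  -- From the Ramsey property to indiscernible sequences.

  module _ {ℓ : Level} {L′ L : Language ℓ} (N : Structure L′) (M : Structure L) {Λ : Set ℓ}
           (a : Sequence N M {Λ}) where

    -- φ(x_i) ⇒ φ(x_j) for i ∼ j, and φ(x_i) whenever φ(a_j) holds for all j ∼ i:
    -- the assignments of the variables satisfying these axioms are exactly the
    -- N-indiscernible sequences based on a.
    private
      IndiscernibilityAxiom SchemaAxiom Axiom : Set ℓ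
      IndiscernibilityAxiom = Σ[ n ∈ ℕ ] Σ[ i ∈ Vector (Carrier N) n ] Σ[ j ∈ Vector (Carrier N) n ]
        qftp N i ≐ qftp N j × Formula L (Fin n × Λ)
      SchemaAxiom = Σ[ n ∈ ℕ ] Σ[ i ∈ Vector (Carrier N) n ] Σ[ φ ∈ Formula L (Fin n × Λ) ]
        (∀ j → qftp N i ≐ qftp N j → Sat M (concat N M a j) φ)
      Axiom = IndiscernibilityAxiom ⊎ SchemaAxiom

      at : ∀ {n} → Vector (Carrier N) n → Fin n × Λ → Carrier N × Λ
      at i (k , l) = i k , l

      axiom : Axiom → Formula L (Carrier N × Λ)
      axiom (inj₁ (_ , i , j , _ , φ)) = rename (at i) φ ⇒′ rename (at j) φ
      axiom (inj₂ (_ , i , φ , _)) = rename (at i) φ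

      indices : Axiom → List (Carrier N)
      indices (inj₁ (_ , i , j , _)) = List.tabulate i ++ List.tabulate j
      indices (inj₂ (_ , i , _)) = List.tabulate i

      colourings : Axiom → List (Colouring N)
      colourings (inj₁ (n , i , _ , _ , φ)) = (n , i , λ w → ⌊ Sat M (concat N M a w) φ ⌋) ∷ []
      colourings (inj₂ _) = []

      satisfied : ∀ {B e} x → (∀ {y} → y ∈ indices x → y ∈ B) → EmbedsOn N B e →
                  All (λ (_ , α , χ) → ConstantOn N B α χ e) (colourings x) →
                  Sat M (uncurry (a ∘ e)) (axiom x)
      satisfied {B} {e} (inj₁ (_ , i , j , eq , φ)) within embeds (const ∷ []) sat =
        cast (sym (Sat-rename M (uncurry (a ∘ e)) (at j) φ))
          (⌊⌋⁻ (trans (const j i wj wi (≐-trans (embeds j wj) (≐-sym eq)) (embeds i wi))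
                      (⌊⌋⁺ (cast (Sat-rename M (uncurry (a ∘ e)) (at i) φ) sat))))
        where
        wi : Within N B i
        wi k = within (∈-++⁺ˡ (∈-tabulate⁺ k))
        wj : Within N B j
        wj k = within (∈-++⁺ʳ (List.tabulate i) (∈-tabulate⁺ k))
      satisfied {B} {e} (inj₂ (_ , i , φ , schema)) within embeds _ =
        cast (sym (Sat-rename M (uncurry (a ∘ e)) (at i) φ))
          (schema (e ∘ i) (≐-sym (embeds i λ k → within (∈-tabulate⁺ k))))

      all-satisfied : ∀ {B e} xs → (∀ {y} → y ∈ List.concatMap indices xs → y ∈ B) → EmbedsOn N B e →
                      All (λ (_ , α , χ) → ConstantOn N B α χ e) (List.concatMap colourings xs) →
                      All (Sat M (uncurry (a ∘ e)) ∘ axiom) xs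
      all-satisfied [] within embeds const = []
      all-satisfied (x ∷ xs) within embeds const =
        satisfied x (within ∘ ∈-++⁺ˡ) embeds (++⁻ˡ (colourings x) const) ∷
        all-satisfied xs (within ∘ ∈-++⁺ʳ (indices x)) embeds (++⁻ʳ (colourings x) const)

      literal : ∀ {ρ : V → Carrier M} → Formula L V → Formula L V
      literal {ρ = ρ} φ = if ⌊ Sat M ρ φ ⌋ then φ else ¬′ φ

      literal-holds : ∀ {ρ : V → Carrier M} φ → Sat M ρ (literal {ρ = ρ} φ)
      literal-holds {ρ = ρ} φ with em {P = Sat M ρ φ}
      ... | yes p = p
      ... | no ¬p = λ p → lift (¬p p)

      literal-agrees : ∀ {ρ σ : V → Carrier M} φ → Sat M σ (literal {ρ = ρ} φ) → Sat M ρ φ ⇔ Sat M σ φ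
      literal-agrees {ρ = ρ} φ lit with em {P = Sat M ρ φ}
      ... | yes p = mk⇔ (λ _ → lit) (λ _ → p)
      ... | no ¬p = mk⇔ (λ p → contradiction p ¬p) (λ q → ⊥-elim (lower (lit q)))

      literals-agree : ∀ {ρ σ : V → Carrier M} {Δ} → All (Sat M σ ∘ literal {ρ = ρ}) Δ →
                       tp[_] M Δ ρ ≐ tp[_] M Δ σ
      literals-agree {ρ = ρ} {σ} {Δ} lits =
        (λ { (sat , inj₁ φ∈) → Equivalence.to (agree φ∈) sat , inj₁ φ∈
           ; (sat , inj₂ (ψ , ψ∈ , refl)) → sat ∘ Equivalence.from (agree ψ∈) , inj₂ (ψ , ψ∈ , refl) }) ,
        (λ { (sat , inj₁ φ∈) → Equivalence.from (agree φ∈) sat , inj₁ φ∈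
           ; (sat , inj₂ (ψ , ψ∈ , refl)) → sat ∘ Equivalence.to (agree ψ∈) , inj₂ (ψ , ψ∈ , refl) })
        where
        agree : ∀ {φ} → φ ∈ Δ → Sat M ρ φ ⇔ Sat M σ φ
        agree φ∈ = literal-agrees _ (All.lookup lits φ∈)

    TupleERP⇒indiscernible : TupleERP N → {K : Set ℓ} → (Carrier N × Λ) ≺ K → Saturated K M →
      Σ[ b ∈ Sequence N M {Λ} ] Indiscernible N M b × _BasedOn_ N M b a
    TupleERP⇒indiscernible erp N×Λ≺K saturated =
      b , (λ n i j eq → (λ {φ} → transfer i j eq φ) , (λ {φ} → transfer j i (≐-sym eq) φ)) , based
      where
      realised = Realisation.realise M saturated N×Λ≺K axiom λ xs →
        let e , embeds , const = simultaneous N erp (List.concatMap indices xs) (List.concatMap colourings xs)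
        in uncurry (a ∘ e) , all-satisfied xs id embeds const

      ρ = proj₁ realised

      b : Sequence N M {Λ}
      b i l = ρ (i , l)

      transfer : ∀ {n} (i j : Vector (Carrier N) n) → qftp N i ≐ qftp N j →
                 ∀ φ → Sat M (concat N M b i) φ → Sat M (concat N M b j) φ
      transfer i j eq φ sat = cast (Sat-rename M ρ (at j) φ)
        (proj₂ realised (inj₁ (_ , i , j , eq , φ)) (cast (sym (Sat-rename M ρ (at i) φ)) sat))

      based : _BasedOn_ N M b a
      -- If no `j` works, then every `a_j` of the same type refutes the literals true of `b_i`. This
      -- is a schema axiom, so `b_i` would refute them as well.
      based n Δ i = by-contradiction λ ¬j →
        let lit = literal {ρ = concat N M b i}
            schema = λ j eq → refute⁺ M lit Δ λ lits → ¬j (j , eq , literals-agree lits)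
        in refute⁻ M lit {is = Δ} (cast (Sat-rename M ρ (at i) (refute lit Δ))
             (proj₂ realised (inj₂ (n , i , refute lit Δ , schema)))) (All.tabulate λ _ → literal-holds _)

  TupleERP⇒ModellingProperty : ∀ {ℓ} {L : Language ℓ} (N : Structure L) → TupleERP N → ModellingProperty N
  TupleERP⇒ModellingProperty N erp L T complete infinite Λ K L≺K N≺K Λ≺K M M⊨T saturated homogeneous a =
    TupleERP⇒indiscernible N M a erp (×-≺ (mk↣ {to = inj₂} inj₂-injective) N≺K Λ≺K L≺K) saturated

  -- Finite restrictions and the generic saturated structure.

  tuples : ∀ n → List A → List (Vector A n)
  tuples zero xs = (λ ()) ∷ []
  tuples (suc n) xs = List.cartesianProductWith Vector._∷_ xs (tuples n xs)

  ∈-tuples⁺ : ∀ {n} {xs : List A} (s : Vector A n) → (∀ k → s k ∈ xs) → s ∈ tuples n xs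
  ∈-tuples⁺ {n = zero} s s∈ = here (ext λ ())
  ∈-tuples⁺ {n = suc n} {xs} s s∈ =
    subst (_∈ tuples (suc n) xs) (ext λ { zero → refl ; (suc k) → refl })
      (∈-cartesianProductWith⁺ Vector._∷_ (s∈ zero) (∈-tuples⁺ (s ∘ suc) (s∈ ∘ suc)))

  -- Merging all variables outside `F` with `nothing` does not affect a formula whose free variables
  -- are `nothing` or in `F`, and leaves only finitely many atoms to control.
  restrict : (F : List A) → Maybe A → Maybe A
  restrict F nothing = nothing
  restrict F (just x) with em {P = x ∈ F}
  ... | yes _ = just x
  ... | no _ = nothing

  restrict-view : (F : List A) (m : Maybe A) → restrict F m ≡ nothing ⊎ ∃ λ x → restrict F m ≡ just x × x ∈ F
  restrict-view F nothing = inj₁ refl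
  restrict-view F (just x) with em {P = x ∈ F}
  ... | yes x∈F = inj₂ (x , refl , x∈F)
  ... | no _ = inj₁ refl

  restrict-∈ : (F : List A) (m : Maybe A) → (∀ {x} → m ≡ just x → x ∈ F) → restrict F m ≡ m
  restrict-∈ F nothing ∈F = refl
  restrict-∈ F (just x) ∈F with em {P = x ∈ F}
  ... | yes _ = refl
  ... | no x∉F = contradiction (∈F refl) x∉F

  -- A saturated structure with one generic n-ary relation which contains X
  -- with the relation T.  An element node c τ realises over the parameters c
  -- the quantifier-free type coded by τ.
  module Generic {ℓ : Level} {X : Set ℓ} (x₀ : X) {K : Set ℓ} (Maybe-K↣K : Maybe K ↣ K)
                 {n : ℕ} (T : Pred (Vector X n) ℓ) where

    data U : Set ℓ where
      leaf : X → U
      node : (K → U) → (Vector (Maybe K) n → Bool) → U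

    -- `top` judges a tuple by the table of a node that occurs in it along with children of that
    -- node only. Well-foundedness makes this node unique. A tuple may have several codes `s` when
    -- children repeat; one accepted code suffices.
    data Holds (u : Vector U n) : Set ℓ where
      leaves : ∀ f → u ≡ leaf ∘ f → T f → Holds u
      top    : ∀ c τ s k → u ≡ maybe′ c (node c τ) ∘ s → s k ≡ nothing → τ s ≡ true → Holds u

    𝓛 : Language ℓ
    Func 𝓛 _ = Lift ℓ ⊥
    Rel 𝓛 m = Lift ℓ (m ≡ n)

    𝓤 : Structure 𝓛
    Carrier 𝓤 = U
    func 𝓤 (lift ()) _
    rel 𝓤 (lift refl) u = Holds u

    leaf-injective : ∀ {x y} → leaf x ≡ leaf y → x ≡ y
    leaf-injective refl = refl

    acyclic : ∀ u {c τ k} → u ≡ node c τ → c k ≢ u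
    acyclic (node c τ) {k = k} refl eq = acyclic (c k) eq refl

    -- Two nodes cannot be children of each other: the recursive call exchanges their roles and
    -- descends to a subtree.
    acyclic₂ : ∀ u {c τ c′ τ′ k l} → u ≡ node c τ → c k ≡ node c′ τ′ → c′ l ≢ u
    acyclic₂ (node c τ) {k = k} refl eq eq′ = acyclic₂ (c k) eq eq′ refl

    abstract
      -- `Q` depends on the values of the parameters and not on their names, because `c` need not be
      -- injective and the relation only sees values.
      generic : {P : Set ℓ₁} → P ↣ K → (c : P → U) (Q : Pred (Vector (Maybe U) n) ℓ) →
                ∃ λ x → (∀ q → c q ≢ x) ×
                (∀ s k → s k ≡ nothing → Holds (maybe′ c x ∘ s) ⇔ Q (Maybe.map c ∘ s))
      generic {P = P} h c Q =
        x , (λ q eq → acyclic x refl (trans (c̃∘h q) eq)) , λ s k sk → mk⇔ (holds⁻ s k sk) (holds⁺ s k sk)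
        where
        c̃ : K → U
        c̃ k with em {P = ∃ λ q → ⟦ h ⟧ q ≡ k}
        ... | yes (q , _) = c q
        ... | no _ = leaf x₀

        c̃∘h : ∀ q → c̃ (⟦ h ⟧ q) ≡ c q
        c̃∘h q with em {P = ∃ λ r → ⟦ h ⟧ r ≡ ⟦ h ⟧ q}
        ... | yes (r , eq) = cong c (↣-injective h eq)
        ... | no ¬p = contradiction (q , refl) ¬p

        τ : Vector (Maybe K) n → Bool
        τ s = ⌊ Q (Maybe.map c̃ ∘ s) ⌋

        x : U
        x = node c̃ τ

        holds⁺ : ∀ s k → s k ≡ nothing → Q (Maybe.map c ∘ s) → Holds (maybe′ c x ∘ s)
        holds⁺ s k sk q = top c̃ τ (Maybe.map ⟦ h ⟧ ∘ s) k (ext (value-at ∘ s)) (cong (Maybe.map ⟦ h ⟧) sk)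
          (⌊⌋⁺ (subst Q (ext (parameter-at ∘ s)) q))
          where
          value-at : ∀ m → maybe′ c x m ≡ maybe′ c̃ x (Maybe.map ⟦ h ⟧ m)
          value-at (just q) = sym (c̃∘h q)
          value-at nothing = refl
          parameter-at : ∀ m → Maybe.map c m ≡ Maybe.map c̃ (Maybe.map ⟦ h ⟧ m)
          parameter-at (just q) = cong just (sym (c̃∘h q))
          parameter-at nothing = refl

        -- In a tuple containing `x` and otherwise only parameters, which are children of `x`, no
        -- node but `x` can be the judging one; another would have `x` as a child and be a child of
        -- `x`.
        same-top : ∀ {c′ τ′} m m′ → x ≡ maybe′ c′ (node c′ τ′) m′ → maybe′ c x m ≡ node c′ τ′ →
                   x ≡ node c′ τ′
        same-top m nothing eq eq′ = eq
        same-top nothing (just l) eq eq′ = eq′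
        same-top (just q) (just l) eq eq′ = ⊥-elim (acyclic₂ x refl (trans (c̃∘h q) eq′) (sym eq))

        parameters-agree : ∀ m m′ → maybe′ c x m ≡ maybe′ c̃ x m′ → Maybe.map c̃ m′ ≡ Maybe.map c m
        parameters-agree (just q) (just l) eq = cong just (sym eq)
        parameters-agree (just q) nothing eq = ⊥-elim (acyclic x refl (trans (c̃∘h q) eq))
        parameters-agree nothing (just l) eq = ⊥-elim (acyclic x refl (sym eq))
        parameters-agree nothing nothing eq = refl

        holds⁻ : ∀ s k → s k ≡ nothing → Holds (maybe′ c x ∘ s) → Q (Maybe.map c ∘ s)
        holds⁻ s k sk (leaves f eq _) =
          contradiction (trans (sym (cong (maybe′ c x) sk)) (cong-app eq k)) λ ()
        holds⁻ s k sk (top c′ τ′ s′ k′ eq sk′ τs′)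
          with same-top (s k′) (s′ k) (trans (sym (cong (maybe′ c x) sk)) (cong-app eq k))
                        (trans (cong-app eq k′) (cong (maybe′ c′ (node c′ τ′)) sk′))
        ... | refl = subst Q (ext λ j → parameters-agree (s j) (s′ j) (cong-app eq j)) (⌊⌋⁻ τs′)

    record _≃_ {V : Set ℓ₁} (u v : V → U) : Set (ℓ ⊔ ℓ₁) where
      field
        ≡-iso   : ∀ i j → u i ≡ u j ⇔ v i ≡ v j
        rel-iso : ∀ (s : Vector V n) → Holds (u ∘ s) ⇔ Holds (v ∘ s)

    open _≃_

    ≃-sym : {u v : V → U} → u ≃ v → v ≃ u
    ≃-sym u≃v = record { ≡-iso = λ i j → ⇔-sym (≡-iso u≃v i j) ; rel-iso = λ s → ⇔-sym (rel-iso u≃v s) }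

    -- A new `x` is matched by a generic element over `v`, related to `v` as `x` is to `u`. If a
    -- tuple of values has several names, `≡-iso` shows that they all give the same answer.
    back-and-forth : {u v : V → U} → V ↣ K → u ≃ v → ∀ x → ∃ λ y → maybe′ u x ≃ maybe′ v y
    back-and-forth {V = V} {u} {v} V↣K u≃v x with em {P = ∃ λ i → u i ≡ x}
    ... | yes (i , refl) = v i , record
      { ≡-iso = λ j k → subst₂ (λ p q → p ⇔ q) (cong₂ _≡_ (at u j) (at u k)) (cong₂ _≡_ (at v j) (at v k))
                          (≡-iso u≃v (maybe′ id i j) (maybe′ id i k))
      ; rel-iso = λ s → subst₂ (λ p q → Holds p ⇔ Holds q) (ext (at u ∘ s)) (ext (at v ∘ s))
                          (rel-iso u≃v (maybe′ id i ∘ s))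
      }
      where
      at : (w : V → U) (j : Maybe V) → w (maybe′ id i j) ≡ maybe′ w (w i) j
      at w (just j) = refl
      at w nothing = refl
    ... | no new = y , record { ≡-iso = ≡-iso′ ; rel-iso = rel-iso′ }
      where
      -- ⌊_⌋ brings the statement down to level ℓ.
      Q : Pred (Vector (Maybe U) n) _
      Q w = Lift ℓ (⌊ (∃ λ s → w ≡ Maybe.map v ∘ s × Holds (maybe′ u x ∘ s)) ⌋ ≡ true)

      y = proj₁ (generic V↣K v Q)
      fresh = proj₁ (proj₂ (generic V↣K v Q))
      holds = proj₂ (proj₂ (generic V↣K v Q))

      ≡-iso′ : ∀ j k → maybe′ u x j ≡ maybe′ u x k ⇔ maybe′ v y j ≡ maybe′ v y k
      ≡-iso′ (just j) (just k) = ≡-iso u≃v j k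
      ≡-iso′ (just j) nothing = mk⇔ (λ eq → contradiction (j , eq) new) (λ eq → contradiction eq (fresh j))
      ≡-iso′ nothing (just k) = mk⇔ (λ eq → contradiction (k , sym eq) new) (λ eq → contradiction (sym eq) (fresh k))
      ≡-iso′ nothing nothing = mk⇔ (λ _ → refl) (λ _ → refl)

      same-tuple : ∀ j k → Maybe.map v j ≡ Maybe.map v k → maybe′ u x k ≡ maybe′ u x j
      same-tuple (just j) (just k) eq = Equivalence.from (≡-iso u≃v k j) (sym (just-injective eq))
      same-tuple nothing nothing eq = refl

      rel-iso′ : ∀ s → Holds (maybe′ u x ∘ s) ⇔ Holds (maybe′ v y ∘ s)
      rel-iso′ s with em {P = ∃ λ k → s k ≡ nothing}
      ... | yes (k , sk) = mk⇔
        (λ h → Equivalence.from (holds s k sk) (lift (⌊⌋⁺ (s , refl , h))))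
        (λ h → let s′ , eq , h′ = ⌊⌋⁻ (lower (Equivalence.to (holds s k sk) h))
               in subst Holds (ext λ j → same-tuple (s j) (s′ j) (cong-app eq j)) h′)
      ... | no ¬hit = subst (λ s → Holds (maybe′ u x ∘ s) ⇔ Holds (maybe′ v y ∘ s))
        (ext λ j → sym (proj₂ (old j))) (rel-iso u≃v (proj₁ ∘ old))
        where
        old : ∀ j → ∃ λ i → s j ≡ just i
        old j = ≢nothing⇒≡just λ sj → ¬hit (j , sj)

    variable-of : Term 𝓛 V → V
    variable-of (var v) = v

    eval-var : (u : V → U) (t : Term 𝓛 V) → eval 𝓤 u t ≡ u (variable-of t)
    eval-var u (var v) = refl

    Maybe-↣ : V ↣ K → Maybe V ↣ K
    Maybe-↣ {V = V} f = Maybe-K↣K ↣-∘ mk↣ {to = Maybe.map ⟦ f ⟧} λ {x} {y} → injective x y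
      where
      injective : ∀ (x y : Maybe V) → Maybe.map ⟦ f ⟧ x ≡ Maybe.map ⟦ f ⟧ y → x ≡ y
      injective (just x) (just y) eq = cong just (↣-injective f (just-injective eq))
      injective nothing nothing _ = refl

    -- Atomic equivalence lifts to all formulas by back-and-forth. Each quantifier adds a variable,
    -- and `Maybe-K↣K` keeps the number of variables within `K`.
    Sat-≃ : {V : Set ℓ₁} → V ↣ K → (φ : Formula 𝓛 V) {u v : V → U} → u ≃ v → Sat 𝓤 u φ → Sat 𝓤 v φ
    Sat-≃ V↣K (s ≈′ t) {u} {v} u≃v eq =
      trans (eval-var v s) (trans (Equivalence.to (≡-iso u≃v _ _)
        (trans (sym (eval-var u s)) (trans eq (eval-var u t)))) (sym (eval-var v t)))
    Sat-≃ V↣K (rel′ (lift refl) ts) {u} {v} u≃v h =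
      subst Holds (ext λ k → sym (eval-var v (ts k)))
        (Equivalence.to (rel-iso u≃v (variable-of ∘ ts)) (subst Holds (ext λ k → eval-var u (ts k)) h))
    Sat-≃ V↣K (φ ⇒′ ψ) u≃v f p = Sat-≃ V↣K ψ u≃v (f (Sat-≃ V↣K φ (≃-sym u≃v) p))
    Sat-≃ V↣K (∀′ φ) u≃v p y =
      let x , v≃u = back-and-forth V↣K (≃-sym u≃v) y in Sat-≃ (Maybe-↣ V↣K) φ (≃-sym v≃u) (p x)

    homogeneous : Homogeneous K 𝓤
    homogeneous P (P↣K , _) c d (p , q) x =
      let y , cx≃dy = back-and-forth P↣K c≃d x
      in y , (λ {φ} → Sat-≃ (Maybe-↣ P↣K) φ cx≃dy) , (λ {φ} → Sat-≃ (Maybe-↣ P↣K) φ (≃-sym cx≃dy))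
      where
      c≃d : c ≃ d
      c≃d = record { ≡-iso = λ i j → mk⇔ (p {var i ≈′ var j}) (q {var i ≈′ var j})
                   ; rel-iso = λ s → mk⇔ (p {rel′ (lift refl) (var ∘ s)}) (q {rel′ (lift refl) (var ∘ s)}) }

    -- If no parameter realises p, a limit t of the atomic profiles of its finite
    -- approximations is the quantifier-free type of a new element realising p.
    module Saturation (P : Set ℓ) (P↣K : P ↣ K) (c : P → U) (p : Pred (Formula 𝓛 (Maybe P)) ℓ)
      (finitely-satisfiable : ∀ Δ → All p Δ → ∃ λ x → All (Sat 𝓤 (maybe′ c x)) Δ)
      (omitted : ∀ q → ∃ λ φ → p φ × ¬ Sat 𝓤 (maybe′ c (c q)) φ) where

      profile : U → Vector (Maybe P) n → Bool
      profile x s = ⌊ Holds (maybe′ c x ∘ s) ⌋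

      limit = compactness {I = Σ (List (Formula 𝓛 (Maybe P))) (All p)}
        (λ (Δ , _) t → ∃ λ x → All (Sat 𝓤 (maybe′ c x)) Δ × t ≡ profile x)
        ([] , [])
        (λ (Δ , ps) (Θ , qs) → (Δ ++ Θ , ++⁺ ps qs) ,
          λ t (x , sat , eq) → (x , ++⁻ˡ Δ sat , eq) , (x , ++⁻ʳ Δ sat , eq))
        (λ (Δ , ps) → let x , sat = finitely-satisfiable Δ ps in profile x , x , sat , refl)

      t : Vector (Maybe P) n → Bool
      t = proj₁ limit

      approximate : ∀ {Δ} → All p Δ → ∀ F → ∃ λ x → All (Sat 𝓤 (maybe′ c x)) Δ ×
                    (∀ {s} → s ∈ F → profile x s ≡ t s)
      approximate ps F =
        let _ , (x , sat , eq) , agree = proj₂ limit (_ , ps) F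
        in x , sat , λ s∈F → trans (cong-app (sym eq) _) (agree s∈F)

      -- The limit is taken over names of parameters, whereas `generic` needs a predicate of values.
      -- Every profile respects equality of values, so their limit does too, two tuples at a time.
      t-cong : ∀ {s s′} → Maybe.map c ∘ s ≡ Maybe.map c ∘ s′ → t s ≡ t s′
      t-cong {s} {s′} eq =
        let x , _ , agree = approximate [] (s ∷ s′ ∷ [])
        in trans (sym (agree (here refl))) (trans
             (cong (λ u → ⌊ Holds u ⌋) (ext λ k → trans (factor x (s k))
               (trans (cong (maybe′ id x) (cong-app eq k)) (sym (factor x (s′ k))))))
             (agree (there (here refl))))
        where
        factor : ∀ x m → maybe′ c x m ≡ maybe′ id x (Maybe.map c m)
        factor x (just q) = refl
        factor x nothing = refl

      Q : Pred (Vector (Maybe U) n) ℓ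
      Q w = ∃ λ s → w ≡ Maybe.map c ∘ s × t s ≡ true

      realisation = generic P↣K c Q

      x = proj₁ realisation

      x-holds : ∀ s k → s k ≡ nothing → Holds (maybe′ c x ∘ s) ⇔ t s ≡ true
      x-holds s k sk = mk⇔
        (λ h → let s′ , eq , ts′ = Equivalence.to (proj₂ (proj₂ realisation) s k sk) h
               in trans (t-cong eq) ts′)
        (λ ts → Equivalence.from (proj₂ (proj₂ realisation) s k sk) (s , refl , ts))

      module _ {φ : Formula 𝓛 (Maybe P)} (pφ : p φ) where

        F : List P
        F = List.catMaybes (fv φ)

        -- Besides `φ`, one formula of `p` failed by each parameter of `φ`: a realisation `y` then
        -- differs from these parameters, just as `x` does, so `y` and `x` agree on equalities too.
        Δ : List (Formula 𝓛 (Maybe P))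
        Δ = φ ∷ List.map (λ q → proj₁ (omitted q)) F

        p-Δ : ∀ F → All p (List.map (λ q → proj₁ (omitted q)) F)
        p-Δ [] = []
        p-Δ (q ∷ F) = proj₁ (proj₂ (omitted q)) ∷ p-Δ F

        approximation = approximate {Δ} (pφ ∷ p-Δ F) (tuples n (nothing ∷ List.map just F))

        y = proj₁ approximation

        y-sat : All (Sat 𝓤 (maybe′ c y)) Δ
        y-sat = proj₁ (proj₂ approximation)

        y-fresh : ∀ {q} → q ∈ F → c q ≢ y
        y-fresh {q} q∈F eq = proj₂ (proj₂ (omitted q))
          (subst (λ z → Sat 𝓤 (maybe′ c z) (proj₁ (omitted q))) (sym eq)
            (All.lookup y-sat (there (∈-map⁺ (λ q → proj₁ (omitted q)) q∈F))))

        r : Maybe P → Maybe P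
        r = restrict F

        y≃x : (maybe′ c y ∘ r) ≃ (maybe′ c x ∘ r)
        y≃x = record { ≡-iso = λ i j → ≡-iso′ (restrict-view F i) (restrict-view F j) ; rel-iso = rel-iso′ }
          where
          View : Maybe P → Set ℓ
          View m = m ≡ nothing ⊎ ∃ λ q → m ≡ just q × q ∈ F

          ≡-iso′ : ∀ {m m′} → View m → View m′ →
                   maybe′ c y m ≡ maybe′ c y m′ ⇔ maybe′ c x m ≡ maybe′ c x m′
          ≡-iso′ (inj₁ refl) (inj₁ refl) = mk⇔ (λ _ → refl) (λ _ → refl)
          ≡-iso′ (inj₁ refl) (inj₂ (q , refl , q∈F)) = mk⇔
            (λ eq → contradiction (sym eq) (y-fresh q∈F))
            (λ eq → contradiction (sym eq) (proj₁ (proj₂ realisation) q))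
          ≡-iso′ (inj₂ (q , refl , q∈F)) (inj₁ refl) = mk⇔
            (λ eq → contradiction eq (y-fresh q∈F))
            (λ eq → contradiction eq (proj₁ (proj₂ realisation) q))
          ≡-iso′ (inj₂ (_ , refl , _)) (inj₂ (_ , refl , _)) = mk⇔ id id

          atom : ∀ s → r ∘ s ∈ tuples n (nothing ∷ List.map just F)
          atom s = ∈-tuples⁺ (r ∘ s) λ k → member (restrict-view F (s k))
            where
            member : ∀ {m} → View m → m ∈ nothing ∷ List.map just F
            member (inj₁ refl) = here refl
            member (inj₂ (_ , refl , q∈F)) = there (∈-map⁺ just q∈F)

          same : ∀ {m} → m ≢ nothing → maybe′ c y m ≡ maybe′ c x m
          same {just q} _ = refl
          same {nothing} ≢nothing = contradiction refl ≢nothing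

          rel-iso′ : ∀ s → Holds (maybe′ c y ∘ r ∘ s) ⇔ Holds (maybe′ c x ∘ r ∘ s)
          rel-iso′ s with em {P = ∃ λ k → r (s k) ≡ nothing}
          ... | no ¬hit = subst (λ u → Holds (maybe′ c y ∘ r ∘ s) ⇔ Holds u)
                            (ext λ k → same λ eq → ¬hit (k , eq)) (⇔-id _)
          ... | yes (k , eq) = mk⇔
            (λ h → Equivalence.from (x-holds (r ∘ s) k eq) (trans (sym agree) (⌊⌋⁺ h)))
            (λ h → ⌊⌋⁻ (trans agree (Equivalence.to (x-holds (r ∘ s) k eq) h)))
            where
            agree : profile y (r ∘ s) ≡ t (r ∘ s)
            agree = proj₂ (proj₂ approximation) (atom s)

        satisfied : Sat 𝓤 (maybe′ c x) φ
        satisfied = cast (sym (local x)) (Sat-≃ (Maybe-↣ P↣K) φ y≃x (cast (local y) (All.head y-sat)))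
          where
          local : ∀ z → Sat 𝓤 (maybe′ c z) φ ≡ Sat 𝓤 (maybe′ c z ∘ r) φ
          local z = Sat-local 𝓤 φ λ {v} v∈ → cong (maybe′ c z)
            (sym (restrict-∈ F v λ eq → ∈-catMaybes⁺ (subst (_∈ fv φ) eq v∈)))

    saturated : Saturated K 𝓤
    saturated P (P↣K , _) c p finitely-satisfiable
      with em {P = ∃ λ q → ∀ φ → p φ → Sat 𝓤 (maybe′ c (c q)) φ}
    ... | yes (q , sat) = c q , λ {φ} → sat φ
    ... | no ¬q = Saturation.x P P↣K c p finitely-satisfiable omitted ,
                  λ {φ} → Saturation.satisfied P P↣K c p finitely-satisfiable omitted
      where
      omitted : ∀ q → ∃ λ φ → p φ × ¬ Sat 𝓤 (maybe′ c (c q)) φ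
      omitted q = by-contradiction λ ¬φ → ¬q (q , λ φ pφ → by-contradiction λ ¬sat → ¬φ (φ , pφ , ¬sat))

    theory : Theory
    theory φ = Sat 𝓤 (λ ()) φ

    Sat-sentence : (M : Structure 𝓛) {ρ σ : ⊥ → Carrier M} (φ : Formula 𝓛 ⊥) → Sat M ρ φ → Sat M σ φ
    Sat-sentence M φ = cast (cong (λ ρ → Sat M ρ φ) (ext λ ()))

    𝓤⊨theory : 𝓤 ⊨ theory
    𝓤⊨theory {φ} = Sat-sentence 𝓤 φ

    complete : Complete theory
    complete = (𝓤 , λ {φ} → 𝓤⊨theory {φ}) , decide
      where
      decide : ∀ φ → theory Entails φ ⊎ theory Entails (¬′ φ)
      decide φ with em {P = Sat 𝓤 (λ ()) φ}
      ... | yes sat = inj₁ λ M M⊨ → Sat-sentence M φ (M⊨ {φ} sat)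
      ... | no ¬sat = inj₂ λ M M⊨ → Sat-sentence M (¬′ φ) (M⊨ {¬′ φ} λ sat → lift (¬sat sat))

  -- Power sets as large cardinals, and the Ramsey property from the modelling property.

  Bool-ext : ∀ {x y} → (x ≡ true → y ≡ true) → (y ≡ true → x ≡ true) → x ≡ y
  Bool-ext {true} p q = sym (p refl)
  Bool-ext {false} {true} p q = q refl
  Bool-ext {false} {false} p q = refl

  cantor : {X : Set ℓ₁} → ¬ ((X → Bool) ↣ X)
  cantor {X = X} f = ¬D-self (⌊⌋⁺ (D , refl , ¬D-self))
    where
    D : X → Bool
    D x = ⌊ (∃ λ g → ⟦ f ⟧ g ≡ x × g x ≢ true) ⌋
    ¬D-self : D (⟦ f ⟧ D) ≢ true
    ¬D-self eq = let g , fg , g≢ = ⌊⌋⁻ eq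
                 in g≢ (subst (λ h → h (⟦ f ⟧ D) ≡ true) (sym (↣-injective f fg)) eq)

  power-↣ : {X : Set ℓ₁} → X ↣ (X → Bool)
  power-↣ = mk↣ {to = λ x y → ⌊ x ≡ y ⌋} λ {x} {y} eq → sym (⌊⌋⁻ (trans (sym (cong-app eq x)) (⌊⌋⁺ refl)))

  power-≻ : {X : Set ℓ₁} {Y : Set ℓ₂} → Y ↣ X → Y ≺ (X → Bool)
  power-≻ f = power-↣ ↣-∘ f , λ g → cantor (f ↣-∘ g)

  module _ {X : Set ℓ₁} where

    private
      -- As in Hilbert's hotel, the coordinates in `ℕ` move up by one, and the freed coordinate 0
      -- marks the additional point.
      shift : Maybe (X ⊎ ℕ → Bool) → X ⊎ ℕ → Bool
      shift nothing (inj₁ _) = false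
      shift nothing (inj₂ zero) = true
      shift nothing (inj₂ (suc _)) = false
      shift (just g) (inj₁ x) = g (inj₁ x)
      shift (just g) (inj₂ zero) = false
      shift (just g) (inj₂ (suc n)) = g (inj₂ n)

      shift-injective : ∀ m m′ → shift m ≡ shift m′ → m ≡ m′
      shift-injective nothing nothing eq = refl
      shift-injective nothing (just g) eq = contradiction (cong-app eq (inj₂ 0)) λ ()
      shift-injective (just g) nothing eq = contradiction (cong-app eq (inj₂ 0)) λ ()
      shift-injective (just g) (just h) eq = cong just (ext λ
        { (inj₁ x) → cong-app eq (inj₁ x) ; (inj₂ n) → cong-app eq (inj₂ (suc n)) })

    Maybe-power-↣ : Maybe (X ⊎ ℕ → Bool) ↣ (X ⊎ ℕ → Bool)
    Maybe-power-↣ = mk↣ {to = shift} λ {m} {m′} → shift-injective m m′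

  -- The relation of the generic structure is the colouring t on the sequence a, so
  -- an indiscernible sequence based on a yields a copy of B homogeneous for t.
  module FromModelling {ℓ : Level} {L : Language ℓ} (N : Structure L) (modelling : ModellingProperty N)
    {n : ℕ} (α : Vector (Carrier N) n) (B : List (Carrier N))
    (t : Vector (Carrier N) n → Bool)
    (bad : ∀ e → EmbedsOn N B e → ¬ ConstantOn N B α t e) where

    -- `X` bounds the language and `N`, so its power set exceeds both by Cantor's theorem. The
    -- summand `ℕ` also provides infinitely many leaves and the room that `Maybe-power-↣` needs.
    X K : Set ℓ
    X = Carrier N ⊎ ℕ
    K = X → Bool

    T : Pred (Vector X n) ℓ
    T f = ∃ λ w → f ≡ inj₁ ∘ w × t w ≡ true

    open Generic {X = X} (inj₂ 0) {K = K} Maybe-power-↣ T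

    𝓛-symbols : Size 𝓛 → X
    𝓛-symbols (inj₁ (inj₁ (_ , lift ())))
    𝓛-symbols (inj₁ (inj₂ _)) = inj₂ 0
    𝓛-symbols (inj₂ k) = inj₂ (suc k)

    𝓛-symbols-injective : ∀ s s′ → 𝓛-symbols s ≡ 𝓛-symbols s′ → s ≡ s′
    𝓛-symbols-injective (inj₁ (inj₁ (_ , lift ())))
    𝓛-symbols-injective (inj₁ (inj₂ _)) (inj₁ (inj₁ (_ , lift ())))
    𝓛-symbols-injective (inj₂ _) (inj₁ (inj₁ (_ , lift ())))
    𝓛-symbols-injective (inj₁ (inj₂ (_ , lift refl))) (inj₁ (inj₂ (_ , lift refl))) eq = refl
    𝓛-symbols-injective (inj₂ k) (inj₂ l) refl = refl

    Λ : Set ℓ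
    Λ = Lift ℓ ⊤

    a : Sequence N 𝓤 {Λ}
    a i _ = leaf (inj₁ i)

    result : Σ[ b ∈ Sequence N 𝓤 {Λ} ] Indiscernible N 𝓤 b × _BasedOn_ N 𝓤 b a
    result = modelling 𝓛 theory complete
      (𝓤 , (λ {φ} → 𝓤⊨theory {φ}) , mk↣ {to = leaf ∘ inj₂} (inj₂-injective ∘ leaf-injective))
      Λ K
      (power-≻ (mk↣ {to = 𝓛-symbols} λ {s} {s′} → 𝓛-symbols-injective s s′))
      (power-≻ (mk↣ {to = inj₁} inj₁-injective))
      (power-≻ (mk↣ {to = λ _ → inj₂ 0} λ _ → refl))
      𝓤 (λ {φ} → 𝓤⊨theory {φ}) saturated homogeneous a

    module _ (b : Sequence N 𝓤 {Λ}) (indiscernible : Indiscernible N 𝓤 b) (based : _BasedOn_ N 𝓤 b a) where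

      β : Vector (Carrier N) (List.length B)
      β = List.lookup B

      atom : ∀ {m} → Vector (Fin m) n → Formula 𝓛 (Fin m × Λ)
      atom f = rel′ (lift refl) λ k → var (f k , lift tt)

      Δ : List (Formula 𝓛 (Fin (List.length B) × Λ))
      Δ = List.map atom (tuples n (List.allFin (List.length B)))

      atom∈Δ : ∀ f → atom f ∈ Δ
      atom∈Δ f = ∈-map⁺ atom (∈-tuples⁺ f λ k → ∈-allFin (f k))

      -- This tuple is the homogeneous copy of `B`: on it the relation between members of `a`, which
      -- is the colour `t`, agrees with the relation between members of `b` on `B`.
      j = proj₁ (based _ Δ β)
      β∼j = proj₁ (proj₂ (based _ Δ β))
      b∼a = proj₂ (proj₂ (based _ Δ β))

      e : Carrier N → Carrier N
      e x with em {P = ∃ λ k → β k ≡ x}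
      ... | yes (k , _) = j k
      ... | no _ = x

      e∘β : ∀ k → e (β k) ≡ j k
      e∘β k with em {P = ∃ λ l → β l ≡ β k}
      ... | yes (l , eq) = qftp-≡ N N β∼j eq
      ... | no ¬p = contradiction (k , refl) ¬p

      position : ∀ {m} {i : Vector (Carrier N) m} → Within N B i → ∃ λ l → i ≡ β ∘ l × e ∘ i ≡ j ∘ l
      position {i = i} wi = l , i≡β∘l , trans (cong (e ∘_) i≡β∘l) (ext λ k → e∘β (l k))
        where
        l = λ k → Any.index (wi k)
        i≡β∘l = ext λ k → lookup-index (wi k)

      embeds : EmbedsOn N B e
      embeds i wi =
        let l , i≡ , e∘i≡ = position wi
        in subst₂ (λ p q → qftp N p ≐ qftp N q) (sym e∘i≡) (sym i≡) (qftp-∘ N N (≐-sym β∼j) l)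

      holds⇔t : ∀ w → Holds (leaf ∘ inj₁ ∘ w) ⇔ t w ≡ true
      holds⇔t w = mk⇔ to (λ tw → leaves (inj₁ ∘ w) refl (w , refl , tw))
        where
        to : Holds (leaf ∘ inj₁ ∘ w) → t w ≡ true
        to (leaves f eq (w′ , refl , tw′)) =
          subst (λ v → t v ≡ true) (ext λ k → sym (inj₁-injective (leaf-injective (cong-app eq k)))) tw′
        to (top c τ s k eq sk _) =
          contradiction (trans (cong-app eq k) (cong (maybe′ c (node c τ)) sk)) λ ()

      -- `atom l` at `β` and `atom id` at `β ∘ l` are the same statement by computation. The second
      -- form has the fixed formula to which indiscernibility of `b` applies.
      t⇔b : ∀ l → t (j ∘ l) ≡ true ⇔ Sat 𝓤 (concat N 𝓤 b (β ∘ l)) (atom id)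
      t⇔b l = mk⇔
        (λ tl → proj₁ (proj₂ b∼a {atom l} (Equivalence.from (holds⇔t (j ∘ l)) tl , inj₁ (atom∈Δ l))))
        (λ h → Equivalence.to (holds⇔t (j ∘ l)) (proj₁ (proj₁ b∼a {atom l} (h , inj₁ (atom∈Δ l)))))

      transfer : ∀ l l′ → qftp N (j ∘ l) ≐ qftp N (j ∘ l′) → t (j ∘ l) ≡ true → t (j ∘ l′) ≡ true
      transfer l l′ eq tl = Equivalence.from (t⇔b l′)
        (proj₁ (indiscernible n (β ∘ l) (β ∘ l′)
          (≐-trans (qftp-∘ N N β∼j l) (≐-trans eq (≐-sym (qftp-∘ N N β∼j l′))))) {atom id}
          (Equivalence.to (t⇔b l) tl))

      constant : ConstantOn N B α t e
      constant i i′ wi wi′ p p′ =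
        let l , _ , eq = position wi
            l′ , _ , eq′ = position wi′
            same = subst₂ (λ v w → qftp N v ≐ qftp N w) eq eq′ (≐-trans p (≐-sym p′))
        in trans (cong t eq) (trans (Bool-ext (transfer l l′ same) (transfer l′ l (≐-sym same)))
                                    (sym (cong t eq′)))

    absurd : ⊥
    absurd = let b , indiscernible , based = result
             in bad (e b indiscernible based) (embeds b indiscernible based) (constant b indiscernible based)

  -- Without a Ramsey set each finite `C` has a bad colouring, and one bad for `C ++ D` is bad for
  -- `C` and for `D`; so the sets of bad colourings are directed and `compactness` applies.
  ModellingProperty⇒TupleERP : ∀ {ℓ} {L : Language ℓ} (N : Structure L) → ModellingProperty N → TupleERP N
  ModellingProperty⇒TupleERP {ℓ} N modelling {n} α B = by-contradiction λ ¬C →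
    let t , approximate = compactness Bad []
          (λ C D → C ++ D , λ χ b → (λ e into → b e (∈-++⁺ˡ ∘ into)) , (λ e into → b e (∈-++⁺ʳ C ∘ into)))
          (λ C → by-contradiction λ ¬χ → ¬C (C , λ χ → by-contradiction λ ¬e →
            ¬χ (χ , λ e into embeds constant → ¬e (e , into , embeds , constant))))
    in FromModelling.absurd N modelling α B t λ e embeds constant →
         -- Only the tuples from the image of `B` under `e` matter for constancy. On them `t` agrees
         -- with a colouring that is bad for this very image, so `e` cannot be homogeneous for `t`.
         let χ , b , agree = approximate (List.map e B) (tuples n (List.map e B))
             agree-on = λ i wi → agree (∈-tuples⁺ (e ∘ i) λ k → ∈-map⁺ e (wi k))
         in b e (∈-map⁺ e) embeds λ i j wi wj p q →
              trans (agree-on i wi) (trans (constant i j wi wj p q) (sym (agree-on j wj)))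
    where
    Bad : List (Carrier N) → (Vector (Carrier N) n → Bool) → Set ℓ
    Bad C χ = ∀ e → (∀ {x} → x ∈ B → e x ∈ C) → EmbedsOn N B e → ¬ ConstantOn N B α χ e

theorem7p9 : (∀ {a : Level} → ExcludedMiddle a) → (∀ {a b : Level} → Extensionality a b) → ∀ {ℓ : Level} (L′ : Language ℓ) (N : Structure L′) → FinitaryERP N ⇔ ModellingProperty N
theorem7p9 em ext L′ N = mk⇔
  (TupleERP⇒ModellingProperty N ∘ FinitaryERP⇒TupleERP N)
  (TupleERP⇒FinitaryERP N ∘ ModellingProperty⇒TupleERP N)
  where open Classical em ext
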